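{- Let $F$ be a field of characteristic zero, and let $\mathrm{ev}_X:\mathrm{NSym}\to A_X$ and $\mathrm{ev}_Y:\mathrm{QSym}\to A_Y$ be algebra morphisms into commutative $F$-algebras; write $f[X]=\mathrm{ev}_X(f)$, $g[Y]=\mathrm{ev}_Y(g)$. Then for all compositions $\lambda,\eta$, $$\mathcal E^{\mathrm{NQ}}[X|Y]\;\mathbf s_{\lambda/\eta}[X]=\sum_{\rho,\mu}S^\vee(\mathcal S_{\eta/\mu})[Y]\;\mathcal S_{\rho/\lambda}[Y]\;\mathbf s_{\rho/\mu}[X],\qquad \mathcal E^{\mathrm{NQ}}[X|Y]=\sum_{\alpha}\mathbf s_\alpha[X]\,\mathcal S_\alpha[Y],$$ where $\rho,\mu,\alpha$ run over all compositions (including the empty one).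
   Context: $\mathrm{NSym}=F\langle H_1,H_2,\dots\rangle$ is the Hopf algebra of noncommutative symmetric functions, $\Delta(H_r)=\sum_{i+j=r}H_i\otimes H_j$ ($H_0=1$); $\mathrm{QSym}$ is the (commutative) Hopf algebra of quasisymmetric functions, with coproduct $\Delta^\vee$ and antipode $S^\vee$; they are graded dual via $\langle H_\alpha,M_\beta\rangle=\delta_{\alpha\beta}$, where $H_\alpha=H_{\alpha_1}H_{\alpha_2}\cdots$ and $M_\beta$ is the monomial basis. $\mathcal S_\alpha$ is the quasisymmetric Schur function of Haglund--Luoto--Mason--van Willigenburg: $\mathcal S_\alpha=\sum_Tx^T$ over all fillings $T$ of the diagram of $\alpha$ (row $i$ from the top has $\alpha_i$ left-justified boxes) by positive integers such that rows weakly decrease left to right, the first column strictly increases top to bottom, and, extending $T$ by zeros to a rectangle, for $i<j$ and $c\ge2$: $T(j,c)\ne0$ and $T(j,c)\ge T(i,c)$ imply $T(j,c)>T(i,c-1)$. The noncommutative Schur functions $\mathbf s_\alpha\in\mathrm{NSym}$ form the dual basis: $\langle\mathbf s_\alpha,\mathcal S_\beta\rangle=\delta_{\alpha\beta}$. Skew elements are defined by $\Delta(\mathbf s_\lambda)=\sum_\eta\mathbf s_{\lambda/\eta}\otimes\mathbf s_\eta$ and $\Delta^\vee(\mathcal S_\lambda)=\sum_\eta\mathcal S_{\lambda/\eta}\otimes\mathcal S_\eta$. Infinite sums are formal and read degreewise: the identity is the image under $\mathrm{ev}_X\otimes\mathrm{ev}_Y$, applied to each total-degree component, of an identity in $\prod_n(\mathrm{NSym}\otimes\mathrm{QSym})_n$.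 -}

module Defs where

open import Algebra.Apartness.Bundles using (HeytingField; HeytingCommutativeRing)
open import Algebra.Bundles using (CommutativeRing)
open import Algebra.Bundles.Raw using (RawRing)
open import Algebra.Module.Bundles.Raw using (RawLeftModule)
open import Algebra.Module.Morphism.Structures using (module LeftModuleMorphisms)
open import Algebra.Module.Structures using (IsLeftModule)
open import Algebra.Morphism.Structures using (module RingMorphisms)
open import Algebra.Structures using (IsCommutativeRing)
import Algebra.Definitions.RawMonoid as RawMonoidDefs
open import Data.Bool.Base using (if_then_else_)
open import Data.Fin.Base using (Fin; toℕ)
import Data.Fin.Properties as Fin
open import Data.List.Base hiding (sum)
open import Data.List.Properties using (≡-dec)
open import Data.List.Relation.Unary.All as All using (All)
open import Data.List.Relation.Unary.Linked as Linked using (Linked)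
open import Data.Nat.Base as ℕ using (ℕ; zero; suc; _∸_; _⊔_; _≤_; _<_; _≥_)
open import Data.Nat.ListAction using (sum)
import Data.Nat.Properties as ℕ
open import Data.Product.Base using (_×_; _,_; ∃-syntax; map₁; uncurry)
open import Function.Base using (id; _∘_)
open import Level as L using (Level)
open import Relation.Binary.Core using (Rel)
open import Relation.Binary.Definitions using (DecidableEquality)
open import Relation.Binary.PropositionalEquality using (_≡_; _≢_; refl; cong)
open import Relation.Nullary using (¬_; Dec; does; ¬?; _×-dec_; _→-dec_)
open import Relation.Nullary.Decidable using (map′)

Eventually : ∀ {p} → (ℕ → Set p) → Set p
Eventually P = ∃[ N ] (∀ m → N ≤ m → P m)

------------------------------------------------------------------------
-- Compositions

record ℕ⁺ : Set where
  constructor 1+_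
  field pred : ℕ

open ℕ⁺ public

⌊_⌋ : ℕ⁺ → ℕ
⌊ 1+ n ⌋ = suc n

_+⁺_ : ℕ⁺ → ℕ⁺ → ℕ⁺
(1+ m) +⁺ (1+ n) = 1+ suc (m ℕ.+ n)

_≟⁺_ : DecidableEquality ℕ⁺
(1+ m) ≟⁺ (1+ n) = map′ (cong 1+_) (cong pred) (m ℕ.≟ n)

Composition : Set
Composition = List ℕ⁺

_≟ᶜ_ : DecidableEquality Composition
_≟ᶜ_ = ≡-dec _≟⁺_

toList : Composition → List ℕ
toList = map ⌊_⌋

∣_∣ : Composition → ℕ
∣ α ∣ = sum (toList α)

-- Every composition of n + 1 arises in exactly one way from one of n, by
-- putting a new part 1 in front or by enlarging the first part by 1.
grow : Composition → List Composition
grow []           = ((1+ 0) ∷ []) ∷ []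
grow ((1+ p) ∷ α) = ((1+ 0) ∷ (1+ p) ∷ α) ∷ ((1+ suc p) ∷ α) ∷ []

compositions : ℕ → List Composition
compositions zero    = [] ∷ []
compositions (suc n) = concatMap grow (compositions n)

compositions≤ : ℕ → List Composition
compositions≤ m = concatMap compositions (upTo (suc m))

quasiShuffle : Composition → Composition → List Composition
quasiShuffle []      β       = β ∷ []
quasiShuffle (a ∷ α) []      = (a ∷ α) ∷ []
quasiShuffle (a ∷ α) (b ∷ β) =
     map (a ∷_)        (quasiShuffle α (b ∷ β))
  ++ map (b ∷_)        (quasiShuffle (a ∷ α) β)
  ++ map ((a +⁺ b) ∷_) (quasiShuffle α β)

-- All (β , γ) with β ++ γ ≡ α.
deconcatenations : Composition → List (Composition × Composition)
deconcatenations []      = ([] , []) ∷ []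
deconcatenations (a ∷ α) = ([] , a ∷ α) ∷ map (map₁ (a ∷_)) (deconcatenations α)

------------------------------------------------------------------------
-- Composition tableaux

-- The list of rows from top to bottom; in diagrams indices start from 0.
Filling : Set
Filling = List (List ℕ)

nth : ∀ {a} {A : Set a} → A → List A → ℕ → A
nth d []       _       = d
nth d (x ∷ _)  zero    = x
nth d (_ ∷ xs) (suc n) = nth d xs n

entry : Filling → ℕ → ℕ → ℕ
entry T i c = nth 0 (nth [] T i) c

width : Filling → ℕ
width T = foldr _⊔_ 0 (map length T)

RowsDecrease : Filling → Set
RowsDecrease T = All (Linked _≥_) T

FirstColumnIncreases : Filling → Set
FirstColumnIncreases T =
  (i j : Fin (length T)) → toℕ i < toℕ j → entry T (toℕ i) 0 < entry T (toℕ j) 0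

-- Here column c is the left neighbour of the column suc c of the rule.
TripleRule : Filling → Set
TripleRule T =
  (i j : Fin (length T)) (c : Fin (width T)) → toℕ i < toℕ j →
  entry T (toℕ j) (suc (toℕ c)) ≢ 0 →
  entry T (toℕ i) (suc (toℕ c)) ≤ entry T (toℕ j) (suc (toℕ c)) →
  entry T (toℕ i) (toℕ c) < entry T (toℕ j) (suc (toℕ c))

IsCompositionTableau : Filling → Set
IsCompositionTableau T = RowsDecrease T × FirstColumnIncreases T × TripleRule T

isCompositionTableau? : (T : Filling) → Dec (IsCompositionTableau T)
isCompositionTableau? T =
  All.all? (Linked.linked? (λ m n → n ℕ.≤? m)) T
  ×-dec Fin.all? (λ i → Fin.all? λ j →
          (toℕ i ℕ.<? toℕ j) →-dec (_ ℕ.<? _))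
  ×-dec Fin.all? (λ i → Fin.all? λ j → Fin.all? λ c →
          (toℕ i ℕ.<? toℕ j) →-dec
          (¬? (_ ℕ.≟ 0) →-dec ((_ ℕ.≤? _) →-dec (_ ℕ.<? _))))

-- Words of length n in the letters 1, …, k.
words : ℕ → ℕ → List (List ℕ)
words k zero    = [] ∷ []
words k (suc n) = cartesianProductWith _∷_ (map suc (upTo k)) (words k n)

fillings : ℕ → Composition → List Filling
fillings k []      = [] ∷ []
fillings k (a ∷ α) = cartesianProductWith _∷_ (words k ⌊ a ⌋) (fillings k α)

-- Exponents of x₁, …, xₖ in the monomial of T.
content : ℕ → Filling → List ℕ
content k T = map (λ v → length (filter (v ℕ.≟_) (concat T))) (map suc (upTo k))

-- The coefficient of x₁^e₁ ⋯ xₖ^eₖ in the sum of xᵀ over the composition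
-- tableaux T of shape α.
tableauCount : Composition → List ℕ → ℕ
tableauCount α e =
  length (filter (λ T → isCompositionTableau? T ×-dec ≡-dec ℕ._≟_ (content k T) e)
                 (fillings k α))
  where k = length e

------------------------------------------------------------------------

-- A HeytingField is nontrivial: if 0# ≈ 1# then 0# - 0# is invertible, so
-- 0# # 0#, contrary to irreflexivity.
module Over {c ℓ₁ ℓ₂} (F : HeytingField c ℓ₁ ℓ₂) where

  𝔽 : CommutativeRing c ℓ₁
  𝔽 = HeytingCommutativeRing.commutativeRing (HeytingField.heytingCommutativeRing F)

  private module K = CommutativeRing 𝔽
  open RawMonoidDefs K.+-rawMonoid using () renaming (_×_ to _×ᴷ_)

  CharacteristicZero : Set ℓ₁
  CharacteristicZero = ∀ n → ¬ (suc n ×ᴷ K.1# K.≈ K.0#)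

  ----------------------------------------------------------------------
  -- Algebras over the field

  record RawAlgebra a ℓ : Set (c L.⊔ L.suc (a L.⊔ ℓ)) where
    infixr 7 _∙_
    field
      rawRing : RawRing a ℓ
    open RawRing rawRing public
    field
      _∙_ : K.Carrier → Carrier → Carrier

    rawLeftModule : RawLeftModule K.Carrier a ℓ
    rawLeftModule = record
      { Carrierᴹ = Carrier ; _≈ᴹ_ = _≈_ ; _+ᴹ_ = _+_
      ; _*ₗ_ = _∙_ ; 0ᴹ = 0# ; -ᴹ_ = -_ }

    ∑ : ∀ {i} {I : Set i} → List I → (I → Carrier) → Carrier
    ∑ is f = foldr (λ i s → f i + s) 0# is

    ∑≤ : ℕ → (Composition → Carrier) → Carrier
    ∑≤ m = ∑ (compositions≤ m)

  open RawAlgebra public using () renaming (Carrier to ⟪_⟫)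

  record CommutativeAlgebra a ℓ : Set (c L.⊔ ℓ₁ L.⊔ L.suc (a L.⊔ ℓ)) where
    field
      rawAlgebra : RawAlgebra a ℓ
    open RawAlgebra rawAlgebra public
    field
      isCommutativeRing : IsCommutativeRing _≈_ _+_ _*_ -_ 0# 1#
      isLeftModule      : IsLeftModule K.ring _≈_ _+_ 0# -_ _∙_
      ∙-*-assoc         : ∀ r x y → ((r ∙ x) * y) ≈ (r ∙ (x * y))

  open CommutativeAlgebra public using (rawAlgebra)

  module _ {a ℓa b ℓb} (A : RawAlgebra a ℓa) (B : RawAlgebra b ℓb) where
    private
      module A = RawAlgebra A
      module B = RawAlgebra B

    record IsAlgebraHomomorphism (f : A.Carrier → B.Carrier)
      : Set (c L.⊔ a L.⊔ ℓa L.⊔ ℓb) where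
      open RingMorphisms A.rawRing B.rawRing
      field
        isRingHomomorphism : IsRingHomomorphism f
        ∙-homo             : ∀ r x → f (r A.∙ x) B.≈ (r B.∙ f x)

    open LeftModuleMorphisms A.rawLeftModule B.rawLeftModule public
      using () renaming (IsLeftModuleHomomorphism to IsLinear)

    -- An element of A ⊗ B is a formal sum of pure tensors, up to the
    -- congruence generated by bilinearity.
    data Tensor≈ : Rel (List (A.Carrier × B.Carrier))
                       (c L.⊔ a L.⊔ ℓa L.⊔ b L.⊔ ℓb) where
      ≈-refl   : ∀ {t} → Tensor≈ t t
      ≈-sym    : ∀ {t u} → Tensor≈ t u → Tensor≈ u t
      ≈-trans  : ∀ {t u v} → Tensor≈ t u → Tensor≈ u v → Tensor≈ t v
      +-cong   : ∀ {t t′ u u′} → Tensor≈ t t′ → Tensor≈ u u′ →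
                 Tensor≈ (t ++ u) (t′ ++ u′)
      +-comm   : ∀ t u → Tensor≈ (t ++ u) (u ++ t)
      ⊗-cong   : ∀ {x x′ y y′} → x A.≈ x′ → y B.≈ y′ →
                 Tensor≈ ((x , y) ∷ []) ((x′ , y′) ∷ [])
      distribʳ : ∀ x x′ y → Tensor≈ ((x A.+ x′ , y) ∷ []) ((x , y) ∷ (x′ , y) ∷ [])
      distribˡ : ∀ x y y′ → Tensor≈ ((x , y B.+ y′) ∷ []) ((x , y) ∷ (x , y′) ∷ [])
      zeroˡ    : ∀ y → Tensor≈ ((A.0# , y) ∷ []) []
      balanced : ∀ r x y → Tensor≈ ((r A.∙ x , y) ∷ []) ((x , r B.∙ y) ∷ [])

    infixr 6 _⊗ᴬ_
    _⊗ᴬ_ : RawAlgebra (a L.⊔ b) (c L.⊔ a L.⊔ ℓa L.⊔ b L.⊔ ℓb)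
    _⊗ᴬ_ = record
      { rawRing = record
        { Carrier = List (A.Carrier × B.Carrier)
        ; _≈_     = Tensor≈
        ; _+_     = _++_
        ; _*_     = cartesianProductWith λ (x , y) (x′ , y′) → x A.* x′ , y B.* y′
        ; -_      = map (map₁ (A.-_))
        ; 0#      = []
        ; 1#      = (A.1# , B.1#) ∷ []
        }
      ; _∙_ = λ r → map (map₁ (r A.∙_))
      }

  infixr 7 _⊗_
  _⊗_ : ∀ {a b} {A : Set a} {B : Set b} → A → B → List (A × B)
  x ⊗ y = (x , y) ∷ []

  infixr 7 _⊗₁_
  _⊗₁_ : ∀ {a a′ b b′} {A : Set a} {A′ : Set a′} {B : Set b} {B′ : Set b′} →
         (A → A′) → (B → B′) → List (A × B) → List (A′ × B′)
  f ⊗₁ g = map λ (x , y) → f x , g y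

  multiply : ∀ {a ℓ} (A : RawAlgebra a ℓ) → ⟪ A ⊗ᴬ A ⟫ → ⟪ A ⟫
  multiply A t = ∑ t (uncurry _*_)
    where open RawAlgebra A

  ----------------------------------------------------------------------
  -- Finite linear combinations of compositions

  Combination : Set c
  Combination = List (K.Carrier × Composition)

  basis : Composition → Combination
  basis α = (K.1# , α) ∷ []

  δ : Composition → Composition → K.Carrier
  δ α β = if does (α ≟ᶜ β) then K.1# else K.0#

  coefficient : Combination → Composition → K.Carrier
  coefficient x β = foldr (λ (r , α) s → r K.* δ α β K.+ s) K.0# x

  linearExtension : ∀ {a ℓ} (A : RawAlgebra a ℓ) →
                    (Composition → ⟪ A ⟫) → Combination → ⟪ A ⟫
  linearExtension A f x = ∑ x λ (r , α) → r ∙ f α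
    where open RawAlgebra A

  -- The algebra with basis the compositions, unit the empty composition,
  -- and α · β the sum of the listed compositions.
  spannedBy : (Composition → Composition → List Composition) → RawAlgebra c ℓ₁
  spannedBy _·_ = record
    { rawRing = record
      { Carrier = Combination
      ; _≈_     = λ x y → ∀ β → coefficient x β K.≈ coefficient y β
      ; _+_     = _++_
      ; _*_     = λ x y → concat (cartesianProductWith
                    (λ (r , α) (s , β) → map (r K.* s ,_) (α · β)) x y)
      ; -_      = map (map₁ (K.-_))
      ; 0#      = []
      ; 1#      = basis []
      }
    ; _∙_ = λ r → map (map₁ (r K.*_))
    }

  component : ℕ → Combination → Combination
  component n = filter λ (_ , α) → ∣ α ∣ ℕ.≟ n

  ----------------------------------------------------------------------
  -- NSym, in the basis H_α, and QSym, in the basis M_α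

  NSym : RawAlgebra c ℓ₁
  NSym = spannedBy λ α β → (α ++ β) ∷ []

  H : ℕ → ⟪ NSym ⟫
  H zero    = RawAlgebra.1# NSym
  H (suc n) = basis ((1+ n) ∷ [])

  Δ : ⟪ NSym ⟫ → ⟪ NSym ⊗ᴬ NSym ⟫
  Δ = linearExtension (NSym ⊗ᴬ NSym) (foldr (λ a t → Δ-H ⌊ a ⌋ * t) 1#)
    where
    open RawAlgebra (NSym ⊗ᴬ NSym)
    Δ-H : ℕ → Carrier
    Δ-H r = ∑ (upTo (suc r)) λ i → H i ⊗ H (r ∸ i)

  -- Quasi-shuffling is the product dual to Δ under ⟨ H_α , M_β ⟩ = δ α β.
  QSym : RawAlgebra c ℓ₁
  QSym = spannedBy quasiShuffle

  Δ∨ : ⟪ QSym ⟫ → ⟪ QSym ⊗ᴬ QSym ⟫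
  Δ∨ = linearExtension (QSym ⊗ᴬ QSym) λ α → map (λ (β , γ) → basis β , basis γ)
                                                (deconcatenations α)

  ε∨ : ⟪ QSym ⟫ → K.Carrier
  ε∨ x = coefficient x []

  record IsAntipode (S : ⟪ QSym ⟫ → ⟪ QSym ⟫) : Set (c L.⊔ ℓ₁) where
    open RawAlgebra QSym
    field
      isLinear : IsLinear QSym QSym S
      inverseˡ : ∀ x → multiply QSym ((S ⊗₁ id) (Δ∨ x)) ≈ (ε∨ x ∙ 1#)
      inverseʳ : ∀ x → multiply QSym ((id ⊗₁ S) (Δ∨ x)) ≈ (ε∨ x ∙ 1#)

  -- The bilinear pairing with ⟨ H_α , M_β ⟩ = δ α β.
  ⟨_,_⟩ : ⟪ NSym ⟫ → ⟪ QSym ⟫ → K.Carrier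
  ⟨ x , y ⟩ = foldr (λ (s , β) t → s K.* coefficient x β K.+ t) K.0# y

  ----------------------------------------------------------------------
  -- Schur functions

  -- A quasisymmetric power series is the combination of the M_β whose
  -- coefficients are those of the monomials x₁^β₁ ⋯ xₖ^βₖ.
  𝒮 : Composition → ⟪ QSym ⟫
  𝒮 α = map (λ β → tableauCount α (toList β) ×ᴷ K.1# , β) (compositions ∣ α ∣)

  IsDualBasis : (Composition → ⟪ NSym ⟫) → Set ℓ₁
  IsDualBasis 𝐬 = ∀ α β → ⟨ 𝐬 α , 𝒮 β ⟩ K.≈ δ α β

  -- In the next two definitions the sum over all η is finite: the partial
  -- sums over ∣ η ∣ ≤ m are eventually equal to the coproduct.
  IsSkewOf𝐬 : (𝐬 : Composition → ⟪ NSym ⟫) →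
              (Composition → Composition → ⟪ NSym ⟫) → Set (c L.⊔ ℓ₁)
  IsSkewOf𝐬 𝐬 _/_ = ∀ α → Eventually λ m → Δ (𝐬 α) ≈ ∑≤ m λ η → (α / η) ⊗ 𝐬 η
    where open RawAlgebra (NSym ⊗ᴬ NSym)

  IsSkewOf𝒮 : (Composition → Composition → ⟪ QSym ⟫) → Set (c L.⊔ ℓ₁)
  IsSkewOf𝒮 _/_ = ∀ α → Eventually λ m → Δ∨ (𝒮 α) ≈ ∑≤ m λ η → (α / η) ⊗ 𝒮 η
    where open RawAlgebra (QSym ⊗ᴬ QSym)

  ----------------------------------------------------------------------
  -- The product over n of the components of NSym ⊗ QSym of total degree n

  NQ : RawAlgebra c (c L.⊔ ℓ₁)
  NQ = NSym ⊗ᴬ QSym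

  totalComponent : ℕ → ⟪ NQ ⟫ → ⟪ NQ ⟫
  totalComponent n = concatMap λ (x , y) →
    map (λ i → component i x , component (n ∸ i) y) (upTo (suc n))

  Series : Set c
  Series = ℕ → ⟪ NQ ⟫

  fromNQ : ⟪ NQ ⟫ → Series
  fromNQ t n = totalComponent n t

  infixl 7 _⋆_
  _⋆_ : Series → Series → Series
  (f ⋆ g) n = ∑ (upTo (suc n)) λ i → f i * g (n ∸ i)
    where open RawAlgebra NQ

  -- Degreewise convergence of a sequence of partial sums.
  infix 4 _⟶_
  _⟶_ : (ℕ → ⟪ NQ ⟫) → Series → Set (c L.⊔ ℓ₁)
  P ⟶ f = ∀ n → Eventually λ m → totalComponent n (P m) ≈ f n
    where open RawAlgebra NQ

-- Every tensor in NSym ⊗ QSym is determined by its coefficients, so the identity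
-- is a family of identities between scalars. Since (𝐬_α) and (𝒮_α) are dual,
-- ∑ 𝐬_α ⊗ 𝒮_α = ∑ H_γ ⊗ M_γ =: K. Comparing coefficients of 𝐬_μ and 𝒮_λ in
-- (Δ ⊗ Δ∨) K gives
--   ∑_ρ 𝐬_{ρ/μ} ⊗ 𝒮_{ρ/λ} = ∑_ν K · (𝐬_{λ/ν} ⊗ 𝒮_{μ/ν}),
-- as quasi-shuffling is dual to Δ and compatible with deconcatenation. Multiplying
-- by S∨(𝒮_{η/μ}) and summing over μ collapses ν to η, because
-- Δ∨ 𝒮_{η/ν} = ∑_μ 𝒮_{η/μ} ⊗ 𝒮_{μ/ν} and S∨ is an antipode. The identity thus holds
-- in the completion of NSym ⊗ QSym, before any evaluation.

module Submission where

open import Algebra.Apartness.Bundles using (HeytingField; HeytingCommutativeRing)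
open import Algebra.Bundles using (CommutativeMonoid; CommutativeRing)
open import Algebra.Module.Morphism.Structures using (module LeftModuleMorphisms)
import Algebra.Properties.CommutativeSemigroup as CommutativeSemigroupProperties
open import Data.Bool.Base using (if_then_else_)
open import Data.Fin.Base using (Fin; zero; suc; punchIn; punchOut)
import Data.Fin.Properties as Fin
open import Data.List.Base hiding (sum; find)
open import Data.List.Membership.Propositional using (_∈_; find; lose)
open import Data.List.Membership.Propositional.Properties
import Data.List.Properties as List
open import Data.List.Relation.Unary.All as All using ([]; _∷_)
import Data.List.Relation.Unary.All.Properties as All
open import Data.List.Relation.Unary.AllPairs as AllPairs using ([]; _∷_)
import Data.List.Relation.Unary.AllPairs.Properties as AllPairs
open import Data.List.Relation.Unary.Any as Any using (here; there)
open import Data.List.Relation.Unary.Any.Properties using (lookup-index)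
open import Data.List.Relation.Unary.Unique.Propositional using (Unique)
import Data.List.Relation.Unary.Unique.Propositional.Properties as Unique
open import Data.Nat.Base as ℕ using (ℕ; zero; suc; _≤_; _<_; _∸_; z≤n; s≤s)
import Data.Nat.Properties as ℕ
open import Data.Product.Base using (_×_; _,_; proj₁; proj₂; ∃₂; ∃-syntax; map₁; uncurry)
open import Data.Sum.Base using (_⊎_; inj₁; inj₂)
open import Function.Base using (_∘_; id)
open import Level using (Level)
open import Relation.Binary.PropositionalEquality as ≡ using (_≡_; _≢_; refl)
import Relation.Binary.Reasoning.Setoid as SetoidReasoning
open import Relation.Nullary using (¬_; Dec; yes; no; does; contradiction)

open import Defs

-- The obstacle is how little is given. `𝐬` is any family with ⟨ 𝐬_α , 𝒮_β ⟩ = δ, not assumed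
-- homogeneous or spanning, and the skew elements are any solutions of their defining equations. In
-- each degree, duality is a one-sided equation W S = 1 of square matrices, with W the coefficients
-- of the 𝒮 in the M. The kernel needs S W = 1 as well. Gaussian elimination supplies it, with
-- pivots found through apartness, since equality in F need not be decidable. Homogeneity of `𝐬` and
-- formulas for the skew elements follow by the same duality.
--
-- Tensors are formal sums modulo a generated congruence, so hypotheses on tensors are read off by
-- bilinear functionals (`eval₂-≈`), and conclusions return through `coefficient₂-injective`.
--
-- Finiteness dictates the order of summation: for fixed μ the sum over ρ is done first. H_α occurs
-- in 𝐬_{ρ/μ} only if |ρ| = |α| + |μ|, and 𝒮_{η/μ} vanishes unless |μ| ≤ |η|. Hence the coefficients
-- at H_α ⊗ M_κ are stable once m is at least |α| + |η| and the coproduct of 𝒮_η has stabilised.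

private variable
  i j : Level
  I : Set i
  J : Set j
  P Q R : Set i

-- Sums over lists in a commutative monoid, for scalars and for formal sums of tensors

module ListSum {c ℓ} (M : CommutativeMonoid c ℓ) where
  open CommutativeMonoid M renaming (refl to ≈-refl; sym to ≈-sym; trans to ≈-trans)
  open import Algebra.Properties.CommutativeSemigroup commutativeSemigroup using (interchange)
  open SetoidReasoning setoid

  ∑ : List I → (I → Carrier) → Carrier
  ∑ is f = foldr (λ i s → f i ∙ s) ε is

  ∑-cong-∈ : {f g : I → Carrier} (is : List I) →
             (∀ {i} → i ∈ is → f i ≈ g i) → ∑ is f ≈ ∑ is g
  ∑-cong-∈ []       f≈g = ≈-refl
  ∑-cong-∈ (i ∷ is) f≈g = ∙-cong (f≈g (here refl)) (∑-cong-∈ is (f≈g ∘ there))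

  ∑-cong : {f g : I → Carrier} (is : List I) → (∀ i → f i ≈ g i) → ∑ is f ≈ ∑ is g
  ∑-cong is f≈g = ∑-cong-∈ is λ {i} _ → f≈g i

  ∑-ε : {f : I → Carrier} (is : List I) → (∀ {i} → i ∈ is → f i ≈ ε) → ∑ is f ≈ ε
  ∑-ε []       f≈ε = ≈-refl
  ∑-ε (i ∷ is) f≈ε = ≈-trans (∙-cong (f≈ε (here refl)) (∑-ε is (f≈ε ∘ there))) (identityˡ ε)

  ∑-++ : (is js : List I) (f : I → Carrier) → ∑ (is ++ js) f ≈ ∑ is f ∙ ∑ js f
  ∑-++ []       js f = ≈-sym (identityˡ _)
  ∑-++ (i ∷ is) js f = ≈-trans (∙-congˡ (∑-++ is js f)) (≈-sym (assoc _ _ _))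

  ∑-concat : (iss : List (List I)) (f : I → Carrier) → ∑ (concat iss) f ≈ ∑ iss λ is → ∑ is f
  ∑-concat []         f = ≈-refl
  ∑-concat (is ∷ iss) f = ≈-trans (∑-++ is (concat iss) f) (∙-congˡ (∑-concat iss f))

  ∑-map : (h : J → I) (js : List J) (f : I → Carrier) → ∑ (map h js) f ≡ ∑ js (f ∘ h)
  ∑-map h []       f = refl
  ∑-map h (j ∷ js) f = ≡.cong (f (h j) ∙_) (∑-map h js f)

  ∑-concatMap : (h : J → List I) (js : List J) (f : I → Carrier) →
                ∑ (concatMap h js) f ≈ ∑ js λ j → ∑ (h j) f
  ∑-concatMap h js f = ≈-trans (∑-concat (map h js) f) (reflexive (∑-map h js _))

  ∑-cartesianProductWith : ∀ {k} {K : Set k} (h : I → J → K) is js (f : K → Carrier) →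
    ∑ (cartesianProductWith h is js) f ≈ ∑ is λ i → ∑ js λ j → f (h i j)
  ∑-cartesianProductWith h []       js f = ≈-refl
  ∑-cartesianProductWith h (i ∷ is) js f = ≈-trans (∑-++ (map (h i) js) _ f)
    (∙-cong (reflexive (∑-map (h i) js f)) (∑-cartesianProductWith h is js f))

  ∑-∙ : (is : List I) (f g : I → Carrier) → ∑ is (λ i → f i ∙ g i) ≈ ∑ is f ∙ ∑ is g
  ∑-∙ []       f g = ≈-sym (identityˡ ε)
  ∑-∙ (i ∷ is) f g = ≈-trans (∙-congˡ (∑-∙ is f g)) (interchange _ _ _ _)

  ∑-swap : (is : List I) (js : List J) (f : I → J → Carrier) →
           ∑ is (λ i → ∑ js (f i)) ≈ ∑ js λ j → ∑ is λ i → f i j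
  ∑-swap []       js f = ≈-sym (∑-ε js λ _ → ≈-refl)
  ∑-swap (i ∷ is) js f = ≈-trans (∙-congˡ (∑-swap is js f)) (≈-sym (∑-∙ js (f i) _))

  ∑-isolate : {is : List I} → Unique is → ∀ {i} → i ∈ is → (f : I → Carrier) →
              (∀ {j} → j ∈ is → j ≢ i → f j ≈ ε) → ∑ is f ≈ f i
  ∑-isolate {is = _ ∷ is} (i∉ ∷ _) (here refl) f f≈ε = ≈-trans
    (∙-congˡ (∑-ε is λ j∈ → f≈ε (there j∈) (≡.≢-sym (All.lookup i∉ j∈)))) (identityʳ _)
  ∑-isolate (j∉ ∷ is!) (there i∈) f f≈ε = ≈-trans
    (∙-cong (f≈ε (here refl) (All.lookup j∉ i∈)) (∑-isolate is! i∈ f (f≈ε ∘ there)))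
    (identityˡ _)

-- Enumeration of compositions without repetition

concatMap-unique : {f : I → List J} {is : List I} → Unique is → (∀ i → Unique (f i)) →
                   (∀ {i i′ j} → j ∈ f i → j ∈ f i′ → i ≡ i′) → Unique (concatMap f is)
concatMap-unique {f = f} {is} is! f! f-disjoint = Unique.concat⁺
  (All.map⁺ (All.universal f! is))
  (AllPairs.map⁺ (AllPairs.map (λ i≢i′ {_} (j∈ , j∈′) → i≢i′ (f-disjoint j∈ j∈′)) is!))

lookup-injective : {is : List I} → Unique is → ∀ {k l} → lookup is k ≡ lookup is l → k ≡ l
lookup-injective (_ ∷ _)    {zero}  {zero}  _  = refl
lookup-injective (i∉ ∷ _)   {zero}  {suc l} eq = contradiction eq (All.lookup i∉ (∈-lookup l))
lookup-injective (i∉ ∷ _)   {suc k} {zero}  eq =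
  contradiction (≡.sym eq) (All.lookup i∉ (∈-lookup k))
lookup-injective (_ ∷ is!)  {suc k} {suc l} eq = ≡.cong suc (lookup-injective is! eq)

-- Undoes one step of `grow`. Since the predecessor of a nonempty composition is thereby unique, the
-- lists `compositions n` are exhaustive and free of repetitions.
shrink : Composition → Composition
shrink []                 = []
shrink ((1+ zero) ∷ α)    = α
shrink ((1+ suc p) ∷ α)   = (1+ p) ∷ α

∈-grow⁺ : ∀ a α → (a ∷ α) ∈ grow (shrink (a ∷ α))
∈-grow⁺ (1+ zero)  []      = here refl
∈-grow⁺ (1+ zero)  (_ ∷ _) = here refl
∈-grow⁺ (1+ suc _) α       = there (here refl)

∈-grow⇒shrink : ∀ α {β} → β ∈ grow α → shrink β ≡ α
∈-grow⇒shrink []      (here refl)         = refl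
∈-grow⇒shrink (_ ∷ _) (here refl)         = refl
∈-grow⇒shrink (_ ∷ _) (there (here refl)) = refl

∈-grow⇒∣∣ : ∀ α {β} → β ∈ grow α → ∣ β ∣ ≡ suc ∣ α ∣
∈-grow⇒∣∣ []      (here refl)         = refl
∈-grow⇒∣∣ (_ ∷ _) (here refl)         = refl
∈-grow⇒∣∣ (_ ∷ _) (there (here refl)) = refl

grow-unique : ∀ α → Unique (grow α)
grow-unique []      = [] ∷ []
grow-unique (_ ∷ _) = ((λ ()) ∷ []) ∷ [] ∷ []

compositions-unique : ∀ n → Unique (compositions n)
compositions-unique zero    = [] ∷ []
compositions-unique (suc n) = concatMap-unique (compositions-unique n) grow-unique
  λ {α} {α′} β∈ β∈′ → ≡.trans (≡.sym (∈-grow⇒shrink α β∈)) (∈-grow⇒shrink α′ β∈′)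

∈-compositions⇒∣∣ : ∀ n {α} → α ∈ compositions n → ∣ α ∣ ≡ n
∈-compositions⇒∣∣ zero    (here refl) = refl
∈-compositions⇒∣∣ (suc n) α∈
  with β , β∈ , α∈β ← find (∈-concatMap⁻ grow {xs = compositions n} α∈)
  = ≡.trans (∈-grow⇒∣∣ β α∈β) (≡.cong suc (∈-compositions⇒∣∣ n β∈))

∈-compositions : ∀ α → α ∈ compositions ∣ α ∣
∈-compositions α = go ∣ α ∣ α refl
  where
  go : ∀ n α → ∣ α ∣ ≡ n → α ∈ compositions n
  go zero    []      _  = here refl
  go (suc n) (a ∷ α) eq = ∈-concatMap⁺ grow (lose
    (go n (shrink (a ∷ α))
        (ℕ.suc-injective (≡.trans (≡.sym (∈-grow⇒∣∣ _ (∈-grow⁺ a α))) eq)))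
    (∈-grow⁺ a α))

compositions≤-unique : ∀ m → Unique (compositions≤ m)
compositions≤-unique m = concatMap-unique (Unique.upTo⁺ (suc m)) compositions-unique
  λ {n} {n′} α∈ α∈′ → ≡.trans (≡.sym (∈-compositions⇒∣∣ n α∈)) (∈-compositions⇒∣∣ n′ α∈′)

∈-compositions≤ : ∀ {m α} → ∣ α ∣ ≤ m → α ∈ compositions≤ m
∈-compositions≤ {α = α} α≤m =
  ∈-concatMap⁺ compositions (lose (∈-upTo⁺ (s≤s α≤m)) (∈-compositions α))

∈-compositions≤⇒∣∣≤ : ∀ m {α} → α ∈ compositions≤ m → ∣ α ∣ ≤ m
∈-compositions≤⇒∣∣≤ m α∈
  with n , n∈ , α∈n ← find (∈-concatMap⁻ compositions {xs = upTo (suc m)} α∈)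
  = ≡.subst (_≤ m) (≡.sym (∈-compositions⇒∣∣ n α∈n)) (ℕ.s≤s⁻¹ (∈-upTo⁻ n∈))

-- Linear algebra over a Heyting field

module LinearAlgebra {c ℓ₁ ℓ₂} (F : HeytingField c ℓ₁ ℓ₂) where
  open HeytingField F using (_#_; #-cotrans; #-irrefl; #⇒invertible; heytingCommutativeRing)
  open import Algebra.Apartness.Properties.HeytingCommutativeRing heytingCommutativeRing
    using (1#0; #-congʳ; x-0≈x; invertibleˡ⇒#)
  open CommutativeRing (HeytingCommutativeRing.commutativeRing heytingCommutativeRing)
    hiding (zero)
    renaming (refl to ≈-refl; sym to ≈-sym; trans to ≈-trans)
  open import Algebra.Properties.Ring ring
    using (-‿distribˡ-*)
  open import Algebra.Properties.Semiring.Sum semiring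
  open import Algebra.Properties.CommutativeSemigroup +-commutativeSemigroup using (interchange)
  open SetoidReasoning setoid

  #0⇒inverse : ∀ {x} → x # 0# → ∃[ y ] y * x ≈ 1#
  #0⇒inverse {x} x#0 with y , yx≈1 , _ ← #⇒invertible x#0
    = y , ≈-trans (*-congˡ (≈-sym (x-0≈x x))) yx≈1

  *#0⇒inverseˡ : ∀ {x y} → x * y # 0# → ∃[ z ] z * x ≈ 1#
  *#0⇒inverseˡ {x} {y} xy#0 with z , z*xy≈1 ← #0⇒inverse xy#0 = z * y , (begin
    z * y * x    ≈⟨ *-assoc _ _ _ ⟩
    z * (y * x)  ≈⟨ *-congˡ (*-comm _ _) ⟩
    z * (x * y)  ≈⟨ z*xy≈1 ⟩
    1#           ∎)

  -- Cotransitivity compares `x` with `x + y` and with 0: either `x` is apart from 0, or `x + y` is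
  -- apart from `x` and their difference `y` is invertible. This stands in for a decision whether a
  -- scalar vanishes, and lets `sum#0⇒` find a pivot.
  +#0⇒ : ∀ x y → x + y # 0# → x # 0# ⊎ y # 0#
  +#0⇒ x y x+y#0 with #-cotrans x+y#0 x
  ... | inj₂ x#0 = inj₁ x#0
  ... | inj₁ x+y#x with z , zy≈1 , _ ← #⇒invertible x+y#x = inj₂ (invertibleˡ⇒# (z , (begin
    z * (y - 0#)       ≈⟨ *-congˡ (x-0≈x y) ⟩
    z * y              ≈⟨ *-congˡ (+-identityʳ y) ⟨
    z * (y + 0#)       ≈⟨ *-congˡ (+-congˡ (-‿inverseʳ x)) ⟨
    z * (y + (x - x))  ≈⟨ *-congˡ (+-assoc _ _ _) ⟨
    z * (y + x - x)    ≈⟨ *-congˡ (+-congʳ (+-comm _ _)) ⟩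
    z * (x + y - x)    ≈⟨ zy≈1 ⟩
    1#                 ∎)))

  sum#0⇒ : ∀ n (f : Fin n → Carrier) → sum f # 0# → ∃[ k ] f k # 0#
  sum#0⇒ zero    f 0#0 = contradiction 0#0 (#-irrefl ≈-refl)
  sum#0⇒ (suc n) f f#0 with +#0⇒ (f zero) (sum (f ∘ suc)) f#0
  ... | inj₁ f₀#0 = zero , f₀#0
  ... | inj₂ s#0  with k , fk#0 ← sum#0⇒ n (f ∘ suc) s#0 = suc k , fk#0

  Matrix : ℕ → Set c
  Matrix n = Fin n → Fin n → Carrier

  _·_ : ∀ {n} → (Fin n → Carrier) → (Fin n → Carrier) → Carrier
  x · y = sum λ j → x j * y j

  ·-remove : ∀ {n} k (x y : Fin (suc n) → Carrier) →
             x · y ≈ x k * y k + (x ∘ punchIn k) · (y ∘ punchIn k)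
  ·-remove k x y = sum-remove {i = k} λ j → x j * y j

  zero-if-punched : ∀ {n} k (x : Fin (suc n) → Carrier) → x k ≈ 0# →
                    (∀ j → x (punchIn k j) ≈ 0#) → ∀ j → x j ≈ 0#
  zero-if-punched k x xₖ≈0 x′≈0 j with k Fin.≟ j
  ... | yes refl = xₖ≈0
  ... | no k≢j   = ≡.subst (λ j → x j ≈ 0#) (Fin.punchIn-punchOut k≢j) (x′≈0 (punchOut k≢j))

  -- Gaussian elimination: A 0 k B k 0 is apart from 0 for some k, so the column
  -- k and the row 0 can be eliminated.
  injective-if-right-inverse : ∀ n (A B : Matrix n) →
    (∀ i → A i · (λ j → B j i) ≈ 1#) →
    (∀ {i l} → i ≢ l → A i · (λ j → B j l) ≈ 0#) →
    (x : Fin n → Carrier) → (∀ i → A i · x ≈ 0#) → ∀ j → x j ≈ 0#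
  injective-if-right-inverse (suc n) A B diagonal off-diagonal x Ax≈0 = x≈0
    where
    pivot : ∃[ k ] A zero k * B k zero # 0#
    pivot = sum#0⇒ (suc n) _ (#-congʳ (≈-sym (diagonal zero)) 1#0)

    k : Fin (suc n)
    k = proj₁ pivot

    inverse : ∃[ q ] q * A zero k ≈ 1#
    inverse = *#0⇒inverseˡ (proj₂ pivot)

    q : Carrier
    q = proj₁ inverse

    factor : Fin n → Carrier
    factor i = - (A (suc i) k * q)

    A′ : Matrix n
    A′ i j = A (suc i) (punchIn k j) + factor i * A zero (punchIn k j)

    -- Row `suc i` plus `factor i` times row 0 has entry 0 in column `k`, so dropping the coordinate
    -- `k` of any `y` loses nothing.
    eliminate : ∀ i (y : Fin (suc n) → Carrier) →
      A′ i · (y ∘ punchIn k) ≈ A (suc i) · y + factor i * (A zero · y)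
    eliminate i y = begin
      sum (λ j → A′ i j * y′ j)                            ≈⟨ sum-cong-≋ {n} (λ j → ≈-trans (distribʳ (y′ j) (a j) _) (+-congˡ (*-assoc _ (b j) (y′ j)))) ⟩
      sum (λ j → a j * y′ j + factor i * (b j * y′ j))     ≈⟨ ∑-distrib-+ (λ j → a j * y′ j) _ ⟩
      sᵃ + sum (λ j → factor i * (b j * y′ j))             ≈⟨ +-congˡ (*-distribˡ-sum (factor i) (λ j → b j * y′ j)) ⟨
      sᵃ + factor i * sᵇ                                   ≈⟨ +-identityˡ _ ⟨
      0# + (sᵃ + factor i * sᵇ)                            ≈⟨ +-congʳ cancel ⟨
      (aₖ + factor i * bₖ) + (sᵃ + factor i * sᵇ)          ≈⟨ interchange _ _ _ _ ⟩
      (aₖ + sᵃ) + (factor i * bₖ + factor i * sᵇ)          ≈⟨ +-congˡ (distribˡ _ _ _) ⟨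
      (aₖ + sᵃ) + factor i * (bₖ + sᵇ)                     ≈⟨ +-cong (·-remove k (A (suc i)) y) (*-congˡ (·-remove k (A zero) y)) ⟨
      A (suc i) · y + factor i * (A zero · y)              ∎
      where
      a b y′ : Fin n → Carrier
      a j = A (suc i) (punchIn k j)
      b j = A zero (punchIn k j)
      y′ = y ∘ punchIn k
      aₖ bₖ sᵃ sᵇ : Carrier
      aₖ = A (suc i) k * y k
      bₖ = A zero k * y k
      sᵃ = a · y′
      sᵇ = b · y′
      cancel : aₖ + factor i * bₖ ≈ 0#
      cancel = begin
        aₖ + factor i * bₖ                           ≈⟨ +-congˡ (-‿distribˡ-* _ _) ⟨
        aₖ - A (suc i) k * q * (A zero k * y k)      ≈⟨ +-congˡ (-‿cong (*-assoc _ _ _)) ⟩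
        aₖ - A (suc i) k * (q * (A zero k * y k))    ≈⟨ +-congˡ (-‿cong (*-congˡ (*-assoc _ _ _))) ⟨
        aₖ - A (suc i) k * (q * A zero k * y k)      ≈⟨ +-congˡ (-‿cong (*-congˡ (*-congʳ (proj₂ inverse)))) ⟩
        aₖ - A (suc i) k * (1# * y k)                ≈⟨ +-congˡ (-‿cong (*-congˡ (*-identityˡ _))) ⟩
        aₖ - aₖ                                      ≈⟨ -‿inverseʳ _ ⟩
        0#                                           ∎

    eliminated : ∀ i y {z} → A (suc i) · y ≈ z → A zero · y ≈ 0# → A′ i · (y ∘ punchIn k) ≈ z
    eliminated i y {z} p p₀ = begin
      A′ i · (y ∘ punchIn k)                   ≈⟨ eliminate i y ⟩
      A (suc i) · y + factor i * (A zero · y)  ≈⟨ +-cong p (*-congˡ p₀) ⟩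
      z + factor i * 0#                        ≈⟨ +-congˡ (zeroʳ _) ⟩
      z + 0#                                   ≈⟨ +-identityʳ z ⟩
      z                                        ∎

    x′≈0 : ∀ j → x (punchIn k j) ≈ 0#
    -- Deleting row `k` and column 0 of `B` leaves a right inverse of `A′`: the remaining columns of
    -- `B` are annihilated by row 0 of `A`, so adding multiples of that row does not change their
    -- products.
    x′≈0 = injective-if-right-inverse n A′ (λ j l → B (punchIn k j) (suc l))
      (λ i → eliminated i (λ j → B j (suc i)) (diagonal (suc i)) (off-diagonal λ ()))
      (λ {i} {l} i≢l → eliminated i (λ j → B j (suc l))
        (off-diagonal (i≢l ∘ Fin.suc-injective)) (off-diagonal λ ()))
      (x ∘ punchIn k)
      (λ i → eliminated i x (Ax≈0 (suc i)) (Ax≈0 zero))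

    xₖ≈0 : x k ≈ 0#
    xₖ≈0 = begin
      x k                           ≈⟨ *-identityˡ _ ⟨
      1# * x k                      ≈⟨ *-congʳ (proj₂ inverse) ⟨
      q * A zero k * x k            ≈⟨ *-assoc _ _ _ ⟩
      q * (A zero k * x k)          ≈⟨ *-congˡ (+-identityʳ _) ⟨
      q * (A zero k * x k + 0#)     ≈⟨ *-congˡ (+-congˡ (sum-replicate-zero n)) ⟨
      q * (A zero k * x k + sum {n} (λ _ → 0#))
        ≈⟨ *-congˡ (+-congˡ (sum-cong-≋ {n} λ j → ≈-trans (*-congˡ (x′≈0 j)) (zeroʳ _))) ⟨
      q * (A zero k * x k + sum (λ j → A zero (punchIn k j) * x (punchIn k j)))
        ≈⟨ *-congˡ (·-remove k (A zero) x) ⟨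
      q * (A zero · x)              ≈⟨ *-congˡ (Ax≈0 zero) ⟩
      q * 0#                        ≈⟨ zeroʳ q ⟩
      0#                            ∎

    x≈0 : ∀ j → x j ≈ 0#
    x≈0 = zero-if-punched k x xₖ≈0 x′≈0

-- NSym and QSym through linear functionals

module Duality {c ℓ₁ ℓ₂} (F : HeytingField c ℓ₁ ℓ₂) where
  open Over F renaming
    ( ≈-refl to ⊗-refl; ≈-sym to ⊗-sym; ≈-trans to ⊗-trans; +-cong to ++-cong; +-comm to ++-comm
    ; distribˡ to ⊗-distribˡ; distribʳ to ⊗-distribʳ; zeroˡ to ⊗-zeroˡ)
  open CommutativeRing 𝔽 hiding (zero)
    renaming (refl to ≈-refl; sym to ≈-sym; trans to ≈-trans)
  open import Algebra.Definitions.RawMonoid +-rawMonoid using () renaming (_×_ to _×ᴷ_)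
  open import Algebra.Properties.CommutativeSemigroup *-commutativeSemigroup
    using () renaming (x∙yz≈y∙xz to x*yz≈y*xz; interchange to *-interchange)
  open import Algebra.Properties.CommutativeSemigroup +-commutativeSemigroup
    using () renaming (x∙yz≈y∙xz to x+yz≈y+xz)
  open import Algebra.Properties.Ring ring using (-‿distribʳ-*; x∙y⁻¹≈ε⇒x≈y)
  open import Algebra.Properties.Semiring.Sum semiring using (sum)
  import Algebra.Solver.CommutativeMonoid +-commutativeMonoid as +-Solver
  open LinearAlgebra F using (injective-if-right-inverse)
  open ListSum +-commutativeMonoid
  open SetoidReasoning setoid

  private
    module ℕ-+ = CommutativeSemigroupProperties ℕ.+-commutativeSemigroup
    module Q   = RawAlgebra QSym
    module N⊗N = RawAlgebra (NSym ⊗ᴬ NSym)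
    module N⊗Q = RawAlgebra NQ

  *-distribˡ-∑ : ∀ c (is : List I) f → c * ∑ is f ≈ ∑ is λ i → c * f i
  *-distribˡ-∑ c []       f = zeroʳ c
  *-distribˡ-∑ c (i ∷ is) f = ≈-trans (distribˡ _ _ _) (+-congˡ (*-distribˡ-∑ c is f))

  *-distribʳ-∑ : ∀ c (is : List I) f → ∑ is f * c ≈ ∑ is λ i → f i * c
  *-distribʳ-∑ c is f = ≈-trans (*-comm _ _) (≈-trans (*-distribˡ-∑ c is f)
    (∑-cong is λ i → *-comm _ _))

  ∑≤ : ℕ → (Composition → Carrier) → Carrier
  ∑≤ m = ∑ (compositions≤ m)

  -- Indicators

  ⟦_⟧ : ∀ {p} {P : Set p} → Dec P → Carrier
  ⟦ P? ⟧ = if does P? then 1# else 0#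

  ⟦⟧-true : (P? : Dec P) → P → ⟦ P? ⟧ ≈ 1#
  ⟦⟧-true (yes _) _ = ≈-refl
  ⟦⟧-true (no ¬p) p = contradiction p ¬p

  ⟦⟧-false : (P? : Dec P) → ¬ P → ⟦ P? ⟧ ≈ 0#
  ⟦⟧-false (yes p) ¬p = contradiction p ¬p
  ⟦⟧-false (no _)  _  = ≈-refl

  ⟦⟧-⇔ : (P? : Dec P) (Q? : Dec Q) → (P → Q) → (Q → P) → ⟦ P? ⟧ ≈ ⟦ Q? ⟧
  ⟦⟧-⇔ (yes p) Q?      P⇒Q Q⇒P = ≈-sym (⟦⟧-true Q? (P⇒Q p))
  ⟦⟧-⇔ (no ¬p) (yes q) P⇒Q Q⇒P = contradiction (Q⇒P q) ¬p
  ⟦⟧-⇔ (no ¬p) (no _)  P⇒Q Q⇒P = ≈-refl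

  ⟦⟧-*-cong : (P? : Dec P) {x y : Carrier} → (P → x ≈ y) → ⟦ P? ⟧ * x ≈ ⟦ P? ⟧ * y
  ⟦⟧-*-cong (yes p) x≈y = *-congˡ (x≈y p)
  ⟦⟧-*-cong (no _)  x≈y = ≈-trans (zeroˡ _) (≈-sym (zeroˡ _))

  ⟦⟧-× : (P? : Dec P) (Q? : Dec Q) (R? : Dec R) →
         (P → Q → R) → (R → P) → (R → Q) → ⟦ P? ⟧ * ⟦ Q? ⟧ ≈ ⟦ R? ⟧
  ⟦⟧-× (yes p) (yes q) R? f _ _ = ≈-trans (*-identityˡ _) (≈-sym (⟦⟧-true R? (f p q)))
  ⟦⟧-× (no ¬p) Q?      R? _ g _ = ≈-trans (zeroˡ _) (≈-sym (⟦⟧-false R? (¬p ∘ g)))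
  ⟦⟧-× P?      (no ¬q) R? _ _ h = ≈-trans (zeroʳ _) (≈-sym (⟦⟧-false R? (¬q ∘ h)))

  ∑-select : ∀ {is : List I} {i} → Unique is → i ∈ is → (i≟ : ∀ j → Dec (i ≡ j))
             (f : I → Carrier) → ∑ is (λ j → ⟦ i≟ j ⟧ * f j) ≈ f i
  ∑-select {is = is} {i} is! i∈ i≟ f = begin
    ∑ is (λ j → ⟦ i≟ j ⟧ * f j)  ≈⟨ ∑-isolate is! i∈ _ (λ {j} _ j≢i →
                                      ≈-trans (*-congʳ (⟦⟧-false (i≟ j) (≡.≢-sym j≢i))) (zeroˡ _)) ⟩
    ⟦ i≟ i ⟧ * f i               ≈⟨ *-congʳ (⟦⟧-true (i≟ i) refl) ⟩
    1# * f i                     ≈⟨ *-identityˡ _ ⟩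
    f i                          ∎

  ∑≤-δ : ∀ {m α} → ∣ α ∣ ≤ m → (f : Composition → Carrier) → ∑≤ m (λ β → δ α β * f β) ≈ f α
  ∑≤-δ {m} {α} α≤m = ∑-select (compositions≤-unique m) (∈-compositions≤ α≤m) (α ≟ᶜ_)

  δ-sym : ∀ α β → δ α β ≈ δ β α
  δ-sym α β = ⟦⟧-⇔ (α ≟ᶜ β) (β ≟ᶜ α) ≡.sym ≡.sym

  -- Linear functionals on combinations and on their tensors

  -- Two notions are definitionally instances: `coefficient x β` is `eval x (λ α → δ α β)`, and
  -- `⟨ x , y ⟩` is `eval y (coefficient x)`.
  eval : Combination → (Composition → Carrier) → Carrier
  eval x f = ∑ x λ (r , α) → r * f α

  eval-cong : ∀ x {f g} → (∀ α → f α ≈ g α) → eval x f ≈ eval x g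
  eval-cong x f≈g = ∑-cong x λ (r , α) → *-congˡ (f≈g α)

  eval-∑ : ∀ x (is : List I) (f : Composition → I → Carrier) →
           eval x (λ α → ∑ is (f α)) ≈ ∑ is λ i → eval x λ α → f α i
  eval-∑ x is f = ≈-trans (∑-cong x λ (r , α) → *-distribˡ-∑ r is (f α)) (∑-swap x is _)

  eval-*ˡ : ∀ x c f → eval x (λ α → c * f α) ≈ c * eval x f
  eval-*ˡ x c f = ≈-trans (∑-cong x λ _ → x*yz≈y*xz _ _ _) (≈-sym (*-distribˡ-∑ c x _))

  eval-*ʳ : ∀ x c f → eval x (λ α → f α * c) ≈ eval x f * c
  eval-*ʳ x c f = ≈-trans (eval-cong x λ _ → *-comm _ c) (≈-trans (eval-*ˡ x c f) (*-comm c _))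

  eval-swap : ∀ x y (f : Composition → Composition → Carrier) →
              eval x (λ α → eval y (f α)) ≈ eval y λ β → eval x λ α → f α β
  eval-swap x y f = ≈-trans (eval-∑ x y _) (∑-cong y λ (s , β) → eval-*ˡ x s _)

  eval-0 : ∀ x {f} → (∀ α → f α ≈ 0#) → eval x f ≈ 0#
  eval-0 x f≈0 = ∑-ε x λ {(r , α)} _ → ≈-trans (*-congˡ (f≈0 α)) (zeroʳ r)

  eval-monomial : ∀ r α f → eval ((r , α) ∷ []) f ≈ r * f α
  eval-monomial r α f = +-identityʳ _

  eval-basis : ∀ α f → eval (basis α) f ≈ f α
  eval-basis α f = ≈-trans (eval-monomial 1# α f) (*-identityˡ _)

  eval-scale : ∀ c x f → eval (map (map₁ (c *_)) x) f ≈ c * eval x f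
  eval-scale c x f = begin
    eval (map (map₁ (c *_)) x) f   ≡⟨ ∑-map (map₁ (c *_)) x _ ⟩
    ∑ x (λ (r , α) → c * r * f α)  ≈⟨ ∑-cong x (λ _ → *-assoc _ _ _) ⟩
    ∑ x (λ (r , α) → c * (r * f α)) ≈⟨ *-distribˡ-∑ c x _ ⟨
    c * eval x f                   ∎

  infix 4 _≋_
  _≋_ : Combination → Combination → Set ℓ₁
  x ≋ y = ∀ β → coefficient x β ≈ coefficient y β

  -- A combination may list a composition several times, whereas `≋` sees only total coefficients.
  -- Rewriting a sum over the list by coefficients, with a bound independent of `f`, makes `eval`
  -- respect `≋`.
  coefficient-expansion : ∀ x → Eventually λ m →
    ∀ f → eval x f ≈ ∑≤ m λ β → coefficient x β * f β
  coefficient-expansion [] = 0 , λ m _ f → ≈-sym (∑-ε (compositions≤ m) λ _ → zeroˡ _)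
  coefficient-expansion ((r , α) ∷ x) with N , ih ← coefficient-expansion x
    = ∣ α ∣ ℕ.⊔ N , λ m ≤m f → begin
    r * f α + eval x f
      ≈⟨ +-cong (*-congˡ (≈-sym (∑≤-δ (ℕ.m⊔n≤o⇒m≤o _ _ ≤m) f))) (ih m (ℕ.m⊔n≤o⇒n≤o _ _ ≤m) f) ⟩
    r * ∑≤ m (λ β → δ α β * f β) + ∑≤ m (λ β → coefficient x β * f β)
      ≈⟨ +-congʳ (≈-trans (*-distribˡ-∑ r (compositions≤ m) _)
                          (∑-cong (compositions≤ m) λ β → ≈-sym (*-assoc _ _ _))) ⟩
    ∑≤ m (λ β → r * δ α β * f β) + ∑≤ m (λ β → coefficient x β * f β)
      ≈⟨ ∑-∙ (compositions≤ m) _ _ ⟨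
    ∑≤ m (λ β → r * δ α β * f β + coefficient x β * f β)
      ≈⟨ ∑-cong (compositions≤ m) (λ β → ≈-sym (distribʳ _ _ _)) ⟩
    ∑≤ m (λ β → coefficient ((r , α) ∷ x) β * f β) ∎

  eval-≋ : ∀ {x y} → x ≋ y → ∀ f → eval x f ≈ eval y f
  eval-≋ {x} {y} x≋y f
    with M , x-exp ← coefficient-expansion x | N , y-exp ← coefficient-expansion y = begin
    eval x f                               ≈⟨ x-exp m (ℕ.m≤m⊔n M N) f ⟩
    ∑≤ m (λ β → coefficient x β * f β)     ≈⟨ ∑-cong (compositions≤ m) (λ β → *-congʳ (x≋y β)) ⟩
    ∑≤ m (λ β → coefficient y β * f β)     ≈⟨ y-exp m (ℕ.m≤n⊔m M N) f ⟨
    eval y f                               ∎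
    where
    m : ℕ
    m = M ℕ.⊔ N

  Functional₂ : Set c
  Functional₂ = Composition → Composition → Carrier

  eval₂ : List (Combination × Combination) → Functional₂ → Carrier
  eval₂ t f = ∑ t λ (x , y) → eval x λ α → eval y (f α)

  coefficient₂ : List (Combination × Combination) → Functional₂
  coefficient₂ t α β = eval₂ t λ α′ β′ → δ α′ α * δ β′ β

  eval₂-cong : ∀ t {f g} → (∀ α β → f α β ≈ g α β) → eval₂ t f ≈ eval₂ t g
  eval₂-cong t f≈g = ∑-cong t λ (x , y) → eval-cong x λ α → eval-cong y (f≈g α)

  eval₂-∑ : ∀ t (is : List I) (f : Composition → Composition → I → Carrier) →
            eval₂ t (λ α β → ∑ is (f α β)) ≈ ∑ is λ i → eval₂ t λ α β → f α β i
  eval₂-∑ t is f = ≈-trans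
    (∑-cong t λ (x , y) → ≈-trans (eval-cong x λ α → eval-∑ y is (f α)) (eval-∑ x is _))
    (∑-swap t is _)

  eval₂-*ˡ : ∀ t c f → eval₂ t (λ α β → c * f α β) ≈ c * eval₂ t f
  eval₂-*ˡ t c f = ≈-trans
    (∑-cong t λ (x , y) → ≈-trans (eval-cong x λ α → eval-*ˡ y c (f α)) (eval-*ˡ x c _))
    (≈-sym (*-distribˡ-∑ c t _))

  eval₂-⊗ : ∀ x y f → eval₂ (x ⊗ y) f ≈ eval x λ α → eval y (f α)
  eval₂-⊗ x y f = +-identityʳ _

  eval₂-⊗-* : ∀ x y f g → eval₂ (x ⊗ y) (λ α β → f α * g β) ≈ eval x f * eval y g
  eval₂-⊗-* x y f g = ≈-trans (eval₂-⊗ x y _)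
    (≈-trans (eval-cong x λ α → eval-*ˡ y (f α) g) (eval-*ʳ x (eval y g) f))

  eval₂-scale : ∀ c t f → eval₂ (map (map₁ (map (map₁ (c *_)))) t) f ≈ c * eval₂ t f
  eval₂-scale c t f = ≈-trans (reflexive (∑-map _ t _))
    (≈-trans (∑-cong t λ (x , y) → eval-scale c x _) (≈-sym (*-distribˡ-∑ c t _)))

  -- Tensors are determined by their coefficients

  module _ (p q : Composition → Composition → List Composition) where
    private
      module A = RawAlgebra (spannedBy p)
      module B = RawAlgebra (spannedBy q)

    infix 4 _≈⊗_
    _≈⊗_ : List (Combination × Combination) → List (Combination × Combination) → Set _
    _≈⊗_ = Tensor≈ (spannedBy p) (spannedBy q)

    -- A bilinear functional respects every generator of the congruence. This turns hypotheses on
    -- tensors, such as the equations defining the skew elements, into scalar identities.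
    eval₂-≈ : ∀ {t u} → t ≈⊗ u → ∀ f → eval₂ t f ≈ eval₂ u f
    eval₂-≈ ⊗-refl f = ≈-refl
    eval₂-≈ (⊗-sym p) f = ≈-sym (eval₂-≈ p f)
    eval₂-≈ (⊗-trans p q) f = ≈-trans (eval₂-≈ p f) (eval₂-≈ q f)
    eval₂-≈ (++-cong {t} {t′} {u} {u′} p q) f = begin
      eval₂ (t ++ u) f        ≈⟨ ∑-++ t u _ ⟩
      eval₂ t f + eval₂ u f   ≈⟨ +-cong (eval₂-≈ p f) (eval₂-≈ q f) ⟩
      eval₂ t′ f + eval₂ u′ f ≈⟨ ∑-++ t′ u′ _ ⟨
      eval₂ (t′ ++ u′) f      ∎
    eval₂-≈ (++-comm t u) f = begin
      eval₂ (t ++ u) f        ≈⟨ ∑-++ t u _ ⟩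
      eval₂ t f + eval₂ u f   ≈⟨ +-comm _ _ ⟩
      eval₂ u f + eval₂ t f   ≈⟨ ∑-++ u t _ ⟨
      eval₂ (u ++ t) f        ∎
    eval₂-≈ (⊗-cong {x} {x′} {y} {y′} x≈x′ y≈y′) f =
      +-congʳ (≈-trans (eval-≋ {x} {x′} x≈x′ _) (eval-cong x′ λ α → eval-≋ {y} {y′} y≈y′ (f α)))
    eval₂-≈ (⊗-distribʳ x x′ y) f = ≈-trans (+-congʳ (∑-++ x x′ _)) (+-assoc _ _ _)
    eval₂-≈ (⊗-distribˡ x y y′) f = begin
      eval x (λ α → eval (y ++ y′) (f α)) + 0#
        ≈⟨ +-congʳ (eval-cong x λ α → ∑-++ y y′ _) ⟩
      eval x (λ α → eval y (f α) + eval y′ (f α)) + 0#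
        ≈⟨ +-congʳ (≈-trans (∑-cong x λ (r , α) → distribˡ r _ _) (∑-∙ x _ _)) ⟩
      eval x (λ α → eval y (f α)) + eval x (λ α → eval y′ (f α)) + 0#
        ≈⟨ +-assoc _ _ _ ⟩
      eval x (λ α → eval y (f α)) + (eval x (λ α → eval y′ (f α)) + 0#) ∎
    eval₂-≈ (⊗-zeroˡ y) f = +-identityˡ 0#
    eval₂-≈ (balanced r x y) f = +-congʳ (begin
      eval (r A.∙ x) (λ α → eval y (f α))  ≈⟨ eval-scale r x _ ⟩
      r * eval x (λ α → eval y (f α))      ≈⟨ eval-*ˡ x r _ ⟨
      eval x (λ α → r * eval y (f α))      ≈⟨ eval-cong x (λ α → eval-scale r y (f α)) ⟨
      eval x (λ α → eval (r B.∙ y) (f α))  ∎)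

    ⊗-commutativeMonoid : CommutativeMonoid c _
    ⊗-commutativeMonoid = record
      { Carrier = List (Combination × Combination)
      ; _≈_ = _≈⊗_
      ; _∙_ = _++_
      ; ε   = []
      ; isCommutativeMonoid = record
        { isMonoid = record
          { isSemigroup = record
            { isMagma = record
              { isEquivalence = record { refl = ⊗-refl ; sym = ⊗-sym ; trans = ⊗-trans }
              ; ∙-cong = ++-cong }
            ; assoc = λ t u v → ≡.subst (((t ++ u) ++ v) ≈⊗_) (List.++-assoc t u v) ⊗-refl }
          ; identity = (λ _ → ⊗-refl)
                     , λ t → ≡.subst (t ++ [] ≈⊗_) (List.++-identityʳ t) ⊗-refl }
        ; comm = ++-comm } }

    private module ⊗ = ListSum ⊗-commutativeMonoid

    monomial : Carrier → Composition → Composition → List (Combination × Combination)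
    monomial r α β = ((r , α) ∷ []) ⊗ basis β

    monomial-cong : ∀ {r s} α β → r ≈ s → monomial r α β ≈⊗ monomial s α β
    monomial-cong α β r≈s = ⊗-cong (λ _ → +-congʳ (*-congʳ r≈s)) (λ _ → ≈-refl)

    monomial-0 : ∀ {r} α β → r ≈ 0# → monomial r α β ≈⊗ []
    monomial-0 {r} α β r≈0 = ⊗-trans
      (⊗-cong {x′ = []} {y = basis β} {y′ = basis β}
        (λ γ → ≈-trans (+-identityʳ _) (≈-trans (*-congʳ r≈0) (zeroˡ _))) (λ _ → ≈-refl))
      (⊗-zeroˡ _)

    monomial-+ : ∀ r s α β → monomial (r + s) α β ≈⊗ monomial r α β ++ monomial s α β
    monomial-+ r s α β = ⊗-trans
      (⊗-cong (λ γ → ≈-trans (+-congʳ (distribʳ _ _ _)) (+-assoc _ _ _)) (λ _ → ≈-refl))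
      (⊗-distribʳ ((r , α) ∷ []) ((s , α) ∷ []) (basis β))

    term : List (Combination × Combination) → Composition → Composition →
           List (Combination × Combination)
    term t α β = monomial (coefficient₂ t α β) α β

    expand : ℕ → List (Combination × Combination) → List (Combination × Combination)
    expand m t = ⊗.∑ (compositions≤ m) λ α → ⊗.∑ (compositions≤ m) (term t α)

    expand-cong : ∀ m t u → (∀ α β → coefficient₂ t α β ≈ coefficient₂ u α β) →
                  expand m t ≈⊗ expand m u
    expand-cong m t u eq = ⊗.∑-cong (compositions≤ m) λ α → ⊗.∑-cong (compositions≤ m) λ β →
      monomial-cong α β (eq α β)

    expand-++ : ∀ m t u → expand m (t ++ u) ≈⊗ expand m t ++ expand m u
    expand-++ m t u = ⊗-trans
      (⊗.∑-cong (compositions≤ m) λ α → ⊗-trans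
        (⊗.∑-cong (compositions≤ m) λ β → ⊗-trans
          (monomial-cong α β (∑-++ t u _)) (monomial-+ _ _ α β))
        (⊗.∑-∙ (compositions≤ m) (term t α) (term u α)))
      (⊗.∑-∙ (compositions≤ m) (λ α → ⊗.∑ (compositions≤ m) (term t α))
                               (λ α → ⊗.∑ (compositions≤ m) (term u α)))

    Expandable : List (Combination × Combination) → Set _
    Expandable t = Eventually λ m → t ≈⊗ expand m t

    expandable-≈ : ∀ {t u} → t ≈⊗ u → Expandable u → Expandable t
    expandable-≈ {t} {u} t≈u (N , u-exp) = N , λ m N≤m → ⊗-trans t≈u (⊗-trans (u-exp m N≤m)
      (expand-cong m u t λ α β → ≈-sym (eval₂-≈ t≈u _)))

    expandable-++ : ∀ {t u} → Expandable t → Expandable u → Expandable (t ++ u)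
    expandable-++ {t} {u} (M , t-exp) (N , u-exp) = M ℕ.⊔ N , λ m ≤m → ⊗-trans
      (++-cong (t-exp m (ℕ.m⊔n≤o⇒m≤o M N ≤m)) (u-exp m (ℕ.m⊔n≤o⇒n≤o M N ≤m)))
      (⊗-sym (expand-++ m t u))

    expandable-[] : Expandable []
    expandable-[] = 0 , λ m _ → ⊗-sym (⊗.∑-ε (compositions≤ m) λ {α} _ →
      ⊗.∑-ε (compositions≤ m) λ {β} _ → monomial-0 α β ≈-refl)

    coefficient₂-monomial : ∀ r α β α′ β′ →
      coefficient₂ (monomial r α β) α′ β′ ≈ r * (δ α α′ * δ β β′)
    coefficient₂-monomial r α β α′ β′ = ≈-trans
      (eval₂-⊗ ((r , α) ∷ []) (basis β) λ γ γ′ → δ γ α′ * δ γ′ β′)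
      (≈-trans (eval-monomial r α λ γ → eval (basis β) λ γ′ → δ γ α′ * δ γ′ β′)
               (*-congˡ (eval-basis β λ γ′ → δ α α′ * δ γ′ β′)))

    expandable-monomial : ∀ r α β → Expandable (monomial r α β)
    expandable-monomial r α β = ∣ α ∣ ℕ.⊔ ∣ β ∣ , λ m ≤m → ⊗-sym (⊗-trans
      (⊗.∑-isolate (compositions≤-unique m) (∈-compositions≤ (ℕ.m⊔n≤o⇒m≤o ∣ α ∣ ∣ β ∣ ≤m)) _
        λ {α′} _ α′≢α → ⊗.∑-ε (compositions≤ m) λ {β′} _ → monomial-0 α′ β′
          (≈-trans (coefficient₂-monomial r α β α′ β′) (≈-trans
            (*-congˡ (≈-trans (*-congʳ (⟦⟧-false (α ≟ᶜ α′) (≡.≢-sym α′≢α))) (zeroˡ _))) (zeroʳ r))))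
      (⊗-trans
        (⊗.∑-isolate (compositions≤-unique m) (∈-compositions≤ (ℕ.m⊔n≤o⇒n≤o ∣ α ∣ ∣ β ∣ ≤m)) _
          λ {β′} _ β′≢β → monomial-0 α β′
            (≈-trans (coefficient₂-monomial r α β α β′) (≈-trans
              (*-congˡ (≈-trans (*-congˡ (⟦⟧-false (β ≟ᶜ β′) (≡.≢-sym β′≢β))) (zeroʳ _))) (zeroʳ r))))
        (monomial-cong α β (≈-trans (coefficient₂-monomial r α β α β) (≈-trans
          (*-congˡ (≈-trans (*-cong (⟦⟧-true (α ≟ᶜ α) refl) (⟦⟧-true (β ≟ᶜ β) refl))
                            (*-identityˡ 1#)))
          (*-identityʳ r))))))

    expandable-pure : ∀ x y → Expandable (x ⊗ y)
    expandable-pure [] y = expandable-≈ (⊗-zeroˡ y) expandable-[]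
    expandable-pure ((r , α) ∷ x) y = expandable-≈ (⊗-distribʳ ((r , α) ∷ []) x y)
      (expandable-++ (lemma y) (expandable-pure x y))
      where
      lemma : ∀ y → Expandable (((r , α) ∷ []) ⊗ y)
      -- The congruence has a zero generator on the left only. The right factor `[]` is read as
      -- `0# ∙ []`, and `balanced` moves the scalar 0 to the left factor.
      lemma [] = expandable-≈
        (⊗-trans (⊗-sym (balanced 0# ((r , α) ∷ []) []))
                 (⊗-trans (⊗-cong {x′ = []} (λ _ → ≈-trans (+-identityʳ _)
                             (≈-trans (*-congʳ (zeroˡ r)) (zeroˡ _))) (λ _ → ≈-refl))
                          (⊗-zeroˡ [])))
        expandable-[]
      lemma ((s , β) ∷ y) = expandable-≈ (⊗-distribˡ ((r , α) ∷ []) ((s , β) ∷ []) y)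
        (expandable-++
          (expandable-≈
            (⊗-trans (⊗-cong (λ _ → ≈-refl) (λ _ → +-congʳ (*-congʳ (≈-sym (*-identityʳ s)))))
                     (⊗-sym (balanced s ((r , α) ∷ []) (basis β))))
            (expandable-monomial (s * r) α β))
          (lemma y))

    expandable : ∀ t → Expandable t
    expandable []            = expandable-[]
    expandable ((x , y) ∷ t) = expandable-++ {x ⊗ y} (expandable-pure x y) (expandable t)

    -- Both tensors are congruent to their expansions up to a common bound, and these agree monomial
    -- by monomial.
    coefficient₂-injective : ∀ t u → (∀ α β → coefficient₂ t α β ≈ coefficient₂ u α β) → t ≈⊗ u
    coefficient₂-injective t u eq
      with M , t-exp ← expandable t | N , u-exp ← expandable u =
      ⊗-trans (t-exp (M ℕ.⊔ N) (ℕ.m≤m⊔n M N)) (⊗-trans (expand-cong (M ℕ.⊔ N) t u eq)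
        (⊗-sym (u-exp (M ℕ.⊔ N) (ℕ.m≤n⊔m M N))))

  -- Quasi-shuffles and deconcatenations

  +⁺-comm : ∀ a b → a +⁺ b ≡ b +⁺ a
  +⁺-comm (1+ m) (1+ n) = ≡.cong (λ k → 1+ suc k) (ℕ.+-comm m n)

  +⁺-assoc : ∀ a b c → (a +⁺ b) +⁺ c ≡ a +⁺ (b +⁺ c)
  +⁺-assoc (1+ l) (1+ m) (1+ n) = ≡.cong (λ k → 1+ suc k) (≡.trans
    (≡.cong suc (ℕ.+-assoc l m n)) (≡.sym (ℕ.+-suc l (m ℕ.+ n))))

  ⌊⌋-+⁺ : ∀ a b → ⌊ a +⁺ b ⌋ ≡ ⌊ a ⌋ ℕ.+ ⌊ b ⌋
  ⌊⌋-+⁺ (1+ m) (1+ n) = ≡.cong suc (≡.sym (ℕ.+-suc m n))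

  -- Identities in QSym are stated as equalities of sums of an arbitrary `f` over quasi-shuffles,
  -- which ignores the order in which the compositions are listed.
  ∑Q : Composition → Composition → (Composition → Carrier) → Carrier
  ∑Q α β = ∑ (quasiShuffle α β)

  ∑Q-cong : ∀ α β {f g} → (∀ γ → f γ ≈ g γ) → ∑Q α β f ≈ ∑Q α β g
  ∑Q-cong α β = ∑-cong (quasiShuffle α β)

  ∑Q-∷ : ∀ a α b β f → ∑Q (a ∷ α) (b ∷ β) f ≈
    ∑Q α (b ∷ β) (f ∘ (a ∷_)) + (∑Q (a ∷ α) β (f ∘ (b ∷_)) + ∑Q α β (f ∘ ((a +⁺ b) ∷_)))
  ∑Q-∷ a α b β f = ≈-trans
    (∑-++ (map (a ∷_) (quasiShuffle α (b ∷ β))) _ f)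
    (+-cong (reflexive (∑-map (a ∷_) (quasiShuffle α (b ∷ β)) f)) (≈-trans
      (∑-++ (map (b ∷_) (quasiShuffle (a ∷ α) β)) _ f)
      (+-cong (reflexive (∑-map (b ∷_) (quasiShuffle (a ∷ α) β) f))
              (reflexive (∑-map ((a +⁺ b) ∷_) (quasiShuffle α β) f)))))

  ∑Q-[]ˡ : ∀ β f → ∑Q [] β f ≈ f β
  ∑Q-[]ˡ β f = +-identityʳ _

  ∑Q-[]ʳ : ∀ α f → ∑Q α [] f ≈ f α
  ∑Q-[]ʳ []      f = +-identityʳ _
  ∑Q-[]ʳ (a ∷ α) f = +-identityʳ _

  quasiShuffle-∣∣ : ∀ α β {γ} → γ ∈ quasiShuffle α β → ∣ γ ∣ ≡ ∣ α ∣ ℕ.+ ∣ β ∣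
  quasiShuffle-∣∣ []      β       (here refl) = refl
  quasiShuffle-∣∣ (a ∷ α) []      (here refl) = ≡.sym (ℕ.+-identityʳ _)
  quasiShuffle-∣∣ (a ∷ α) (b ∷ β) γ∈ with ∈-++⁻ (map (a ∷_) (quasiShuffle α (b ∷ β))) γ∈
  ... | inj₁ γ∈ with _ , γ′∈ , refl ← ∈-map⁻ (a ∷_) γ∈ = ≡.trans
    (≡.cong (⌊ a ⌋ ℕ.+_) (quasiShuffle-∣∣ α (b ∷ β) γ′∈)) (≡.sym (ℕ.+-assoc ⌊ a ⌋ _ _))
  ... | inj₂ γ∈ with ∈-++⁻ (map (b ∷_) (quasiShuffle (a ∷ α) β)) γ∈
  ...   | inj₁ γ∈ with _ , γ′∈ , refl ← ∈-map⁻ (b ∷_) γ∈ = ≡.trans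
    (≡.cong (⌊ b ⌋ ℕ.+_) (quasiShuffle-∣∣ (a ∷ α) β γ′∈))
    (ℕ-+.x∙yz≈y∙xz ⌊ b ⌋ (∣ a ∷ α ∣) (∣ β ∣))
  ...   | inj₂ γ∈ with _ , γ′∈ , refl ← ∈-map⁻ ((a +⁺ b) ∷_) γ∈ = ≡.trans
    (≡.cong₂ ℕ._+_ (⌊⌋-+⁺ a b) (quasiShuffle-∣∣ α β γ′∈))
    (ℕ-+.interchange ⌊ a ⌋ ⌊ b ⌋ (∣ α ∣) (∣ β ∣))

  quasiShuffle-comm : ∀ α β f → ∑Q α β f ≈ ∑Q β α f
  quasiShuffle-comm []      β       f = ≈-trans (∑Q-[]ˡ β f) (≈-sym (∑Q-[]ʳ β f))
  quasiShuffle-comm (a ∷ α) []      f = ≈-refl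
  quasiShuffle-comm (a ∷ α) (b ∷ β) f = begin
    ∑Q (a ∷ α) (b ∷ β) f
      ≈⟨ ∑Q-∷ a α b β f ⟩
    ∑Q α (b ∷ β) (f ∘ (a ∷_)) + (∑Q (a ∷ α) β (f ∘ (b ∷_)) + ∑Q α β (f ∘ ((a +⁺ b) ∷_)))
      ≈⟨ +-cong (quasiShuffle-comm α (b ∷ β) _) (+-cong (quasiShuffle-comm (a ∷ α) β _)
           (≈-trans (quasiShuffle-comm α β _) (∑Q-cong β α λ γ →
             reflexive (≡.cong (λ c → f (c ∷ γ)) (+⁺-comm a b))))) ⟩
    ∑Q (b ∷ β) α (f ∘ (a ∷_)) + (∑Q β (a ∷ α) (f ∘ (b ∷_)) + ∑Q β α (f ∘ ((b +⁺ a) ∷_)))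
      ≈⟨ x+yz≈y+xz _ _ _ ⟩
    ∑Q β (a ∷ α) (f ∘ (b ∷_)) + (∑Q (b ∷ β) α (f ∘ (a ∷_)) + ∑Q β α (f ∘ ((b +⁺ a) ∷_)))
      ≈⟨ ∑Q-∷ b β a α f ⟨
    ∑Q (b ∷ β) (a ∷ α) f ∎

  -- The first part of a triple quasi-shuffle is the sum of a nonempty subset of `a`, `b`, `c`. Each
  -- of the seven cases is an instance with fewer parts; the rest is regrouping of the nine sums
  -- obtained by unfolding either side.
  quasiShuffle-assoc : ∀ α β γ f →
    ∑Q α β (λ κ → ∑Q κ γ f) ≈ ∑Q β γ λ κ → ∑Q α κ f
  quasiShuffle-assoc [] β γ f = ≈-trans (∑Q-[]ˡ β λ κ → ∑Q κ γ f)
    (≈-sym (∑Q-cong β γ λ κ → ∑Q-[]ˡ κ f))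
  quasiShuffle-assoc (a ∷ α) [] γ f = ≈-refl
  quasiShuffle-assoc (a ∷ α) (b ∷ β) [] f = ≈-trans
    (∑Q-cong (a ∷ α) (b ∷ β) λ κ → ∑Q-[]ʳ κ f)
    (≈-sym (∑Q-[]ʳ (b ∷ β) λ κ → ∑Q (a ∷ α) κ f))
  quasiShuffle-assoc A@(a ∷ α) B@(b ∷ β) C@(c ∷ γ) f = begin
    ∑Q A B (λ κ → ∑Q κ C f)
      ≈⟨ ∑Q-∷ a α b β _ ⟩
    ∑Q α B (λ κ → ∑Q (a ∷ κ) C f)
      + (∑Q A β (λ κ → ∑Q (b ∷ κ) C f) + ∑Q α β (λ κ → ∑Q ((a +⁺ b) ∷ κ) C f))
      ≈⟨ +-cong (left α B a) (+-cong (left A β b) (left α β (a +⁺ b))) ⟩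
    (∑Q α B (λ κ → ∑Q κ C fₐ) + (∑Q α B (λ κ → ∑Q (a ∷ κ) γ fᶜ) + ∑Q α B (λ κ → ∑Q κ γ fₐᶜ)))
      + ((∑Q A β (λ κ → ∑Q κ C fᵇ) + (∑Q A β (λ κ → ∑Q (b ∷ κ) γ fᶜ) + ∑Q A β (λ κ → ∑Q κ γ fᵇᶜ)))
      + (∑Q α β (λ κ → ∑Q κ C fₐᵇ) + (∑Q α β (λ κ → ∑Q ((a +⁺ b) ∷ κ) γ fᶜ) + ∑Q α β (λ κ → ∑Q κ γ (f ∘ (((a +⁺ b) +⁺ c) ∷_))))))
      ≈⟨ solve 9 (λ x₁ x₂ x₃ y₁ y₂ y₃ z₁ z₂ z₃ →
           (x₁ ⊕ (x₂ ⊕ x₃)) ⊕ ((y₁ ⊕ (y₂ ⊕ y₃)) ⊕ (z₁ ⊕ (z₂ ⊕ z₃)))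
           ⊜ (x₁ ⊕ (y₁ ⊕ z₁)) ⊕ ((x₂ ⊕ (y₂ ⊕ z₂)) ⊕ (x₃ ⊕ (y₃ ⊕ z₃)))) ≈-refl _ _ _ _ _ _ _ _ _ ⟩
    (∑Q α B (λ κ → ∑Q κ C fₐ) + (∑Q A β (λ κ → ∑Q κ C fᵇ) + ∑Q α β (λ κ → ∑Q κ C fₐᵇ)))
      + ((∑Q α B (λ κ → ∑Q (a ∷ κ) γ fᶜ) + (∑Q A β (λ κ → ∑Q (b ∷ κ) γ fᶜ) + ∑Q α β (λ κ → ∑Q ((a +⁺ b) ∷ κ) γ fᶜ)))
      + (∑Q α B (λ κ → ∑Q κ γ fₐᶜ) + (∑Q A β (λ κ → ∑Q κ γ fᵇᶜ) + ∑Q α β (λ κ → ∑Q κ γ (f ∘ (((a +⁺ b) +⁺ c) ∷_))))))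
      ≈⟨ +-cong
           (+-cong (quasiShuffle-assoc α B C fₐ)
             (+-cong (quasiShuffle-assoc A β C fᵇ) (quasiShuffle-assoc α β C fₐᵇ)))
           (+-cong
             -- The three sums in which `c` comes first are the unfolded quasi-shuffles of `A` and
             -- `B`; they are folded back so that one induction step treats them together.
             (≈-trans (≈-sym (∑Q-∷ a α b β λ κ → ∑Q κ γ fᶜ)) (quasiShuffle-assoc A B γ fᶜ))
             (+-cong (quasiShuffle-assoc α B γ fₐᶜ) (+-cong (quasiShuffle-assoc A β γ fᵇᶜ)
               (≈-trans (quasiShuffle-assoc α β γ _) (∑Q-cong β γ λ κ → ∑Q-cong α κ λ ω →
                 reflexive (≡.cong (λ d → f (d ∷ ω)) (+⁺-assoc a b c))))))) ⟩
    (∑Q B C (λ κ → ∑Q α κ fₐ) + (∑Q β C (λ κ → ∑Q A κ fᵇ) + ∑Q β C (λ κ → ∑Q α κ fₐᵇ)))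
      + (∑Q B γ (λ κ → ∑Q A κ fᶜ)
      + (∑Q B γ (λ κ → ∑Q α κ fₐᶜ) + (∑Q β γ (λ κ → ∑Q A κ fᵇᶜ) + ∑Q β γ (λ κ → ∑Q α κ fₐᵇᶜ))))
      -- Symmetrically, the sum in which `a` comes first is unfolded by the first part of the
      -- quasi-shuffles of `B` and `C`.
      ≈⟨ +-congʳ (+-congʳ (∑Q-∷ b β c γ λ κ → ∑Q α κ fₐ)) ⟩
    ((∑Q β C (λ κ → ∑Q α (b ∷ κ) fₐ) + (∑Q B γ (λ κ → ∑Q α (c ∷ κ) fₐ) + ∑Q β γ (λ κ → ∑Q α ((b +⁺ c) ∷ κ) fₐ)))
      + (∑Q β C (λ κ → ∑Q A κ fᵇ) + ∑Q β C (λ κ → ∑Q α κ fₐᵇ)))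
      + (∑Q B γ (λ κ → ∑Q A κ fᶜ)
      + (∑Q B γ (λ κ → ∑Q α κ fₐᶜ) + (∑Q β γ (λ κ → ∑Q A κ fᵇᶜ) + ∑Q β γ (λ κ → ∑Q α κ fₐᵇᶜ))))
      ≈⟨ solve 9 (λ x₁ x₂ x₃ y₁ y₂ y₃ z₁ z₂ z₃ →
           ((x₁ ⊕ (y₁ ⊕ z₁)) ⊕ (x₂ ⊕ x₃)) ⊕ (y₂ ⊕ (y₃ ⊕ (z₂ ⊕ z₃)))
           ⊜ (x₁ ⊕ (x₂ ⊕ x₃)) ⊕ ((y₁ ⊕ (y₂ ⊕ y₃)) ⊕ (z₁ ⊕ (z₂ ⊕ z₃)))) ≈-refl _ _ _ _ _ _ _ _ _ ⟩
    (∑Q β C (λ κ → ∑Q α (b ∷ κ) fₐ) + (∑Q β C (λ κ → ∑Q A κ fᵇ) + ∑Q β C (λ κ → ∑Q α κ fₐᵇ)))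
      + ((∑Q B γ (λ κ → ∑Q α (c ∷ κ) fₐ) + (∑Q B γ (λ κ → ∑Q A κ fᶜ) + ∑Q B γ (λ κ → ∑Q α κ fₐᶜ)))
      + (∑Q β γ (λ κ → ∑Q α ((b +⁺ c) ∷ κ) fₐ) + (∑Q β γ (λ κ → ∑Q A κ fᵇᶜ) + ∑Q β γ (λ κ → ∑Q α κ fₐᵇᶜ))))
      ≈⟨ +-cong (right β C b) (+-cong (right B γ c) (right β γ (b +⁺ c))) ⟨
    ∑Q β C (λ κ → ∑Q A (b ∷ κ) f)
      + (∑Q B γ (λ κ → ∑Q A (c ∷ κ) f) + ∑Q β γ (λ κ → ∑Q A ((b +⁺ c) ∷ κ) f))
      ≈⟨ ∑Q-∷ b β c γ _ ⟨
    ∑Q B C (λ κ → ∑Q A κ f) ∎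
    where
    open +-Solver
    fₐ fᵇ fᶜ fₐᵇ fₐᶜ fᵇᶜ fₐᵇᶜ : Composition → Carrier
    fₐ   = f ∘ (a ∷_)
    fᵇ   = f ∘ (b ∷_)
    fᶜ   = f ∘ (c ∷_)
    fₐᵇ  = f ∘ ((a +⁺ b) ∷_)
    fₐᶜ  = f ∘ ((a +⁺ c) ∷_)
    fᵇᶜ  = f ∘ ((b +⁺ c) ∷_)
    fₐᵇᶜ = f ∘ ((a +⁺ (b +⁺ c)) ∷_)

    ∑Q-+++ : ∀ α β f g h → ∑Q α β (λ κ → f κ + (g κ + h κ)) ≈ ∑Q α β f + (∑Q α β g + ∑Q α β h)
    ∑Q-+++ α β f g h = ≈-trans (∑-∙ (quasiShuffle α β) f _)
      (+-congˡ (∑-∙ (quasiShuffle α β) g h))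

    left : ∀ α β e → ∑Q α β (λ κ → ∑Q (e ∷ κ) C f) ≈
      ∑Q α β (λ κ → ∑Q κ C (f ∘ (e ∷_)))
      + (∑Q α β (λ κ → ∑Q (e ∷ κ) γ fᶜ) + ∑Q α β (λ κ → ∑Q κ γ (f ∘ ((e +⁺ c) ∷_))))
    left α β e = ≈-trans (∑Q-cong α β λ κ → ∑Q-∷ e κ c γ f) (∑Q-+++ α β _ _ _)

    right : ∀ β γ e → ∑Q β γ (λ κ → ∑Q A (e ∷ κ) f) ≈
      ∑Q β γ (λ κ → ∑Q α (e ∷ κ) fₐ)
      + (∑Q β γ (λ κ → ∑Q A κ (f ∘ (e ∷_))) + ∑Q β γ (λ κ → ∑Q α κ (f ∘ ((a +⁺ e) ∷_))))
    right β γ e = ≈-trans (∑Q-cong β γ λ κ → ∑Q-∷ a α e κ f) (∑Q-+++ β γ _ _ _)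

  ∑D : Composition → Functional₂ → Carrier
  ∑D α h = ∑ (deconcatenations α) λ (β , γ) → h β γ

  ∑D-cong : ∀ α {h k} → (∀ β γ → h β γ ≈ k β γ) → ∑D α h ≈ ∑D α k
  ∑D-cong α h≈k = ∑-cong (deconcatenations α) λ (β , γ) → h≈k β γ

  ∑D-∷ : ∀ a α h → ∑D (a ∷ α) h ≈ h [] (a ∷ α) + ∑D α (h ∘ (a ∷_))
  ∑D-∷ a α h = +-congˡ (reflexive (∑-map (map₁ (a ∷_)) (deconcatenations α) _))

  ∑D-+ : ∀ α h k → ∑D α (λ β γ → h β γ + k β γ) ≈ ∑D α h + ∑D α k
  ∑D-+ α h k = ∑-∙ (deconcatenations α) _ _

  ∑Q-∑D : Composition → Composition → Functional₂ → Carrier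
  ∑Q-∑D α β h = ∑Q α β λ κ → ∑D κ h

  ∑D-∑Q : Composition → Composition → Functional₂ → Carrier
  ∑D-∑Q α β h = ∑D α λ α₁ α₂ → ∑D β λ β₁ β₂ → ∑Q α₁ β₁ λ κ → ∑Q α₂ β₂ (h κ)

  -- The bialgebra axiom of QSym. A cut of a quasi-shuffle either has an empty left piece or a left
  -- piece that begins with `a`, `b` or `a +⁺ b`; induction treats the three nonempty cases.
  deconcatenation-quasiShuffle : ∀ α β h → ∑Q-∑D α β h ≈ ∑D-∑Q α β h
  deconcatenation-quasiShuffle [] β h = ≈-trans (∑Q-[]ˡ β λ κ → ∑D κ h) (≈-sym (≈-trans
    (+-identityʳ _) (∑D-cong β λ β₁ β₂ → ≈-trans (∑Q-[]ˡ β₁ λ κ → ∑Q [] β₂ (h κ)) (∑Q-[]ˡ β₂ (h β₁)))))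
  deconcatenation-quasiShuffle (a ∷ α) [] h = ≈-trans (∑Q-[]ʳ (a ∷ α) λ κ → ∑D κ h) (≈-sym
    (∑D-cong (a ∷ α) λ α₁ α₂ → ≈-trans (+-identityʳ _)
      (≈-trans (∑Q-[]ʳ α₁ λ κ → ∑Q α₂ [] (h κ)) (∑Q-[]ʳ α₂ (h α₁)))))
  deconcatenation-quasiShuffle A@(a ∷ α) B@(b ∷ β) h = begin
    ∑Q A B (λ κ → ∑D κ h)
      ≈⟨ ∑Q-∷ a α b β _ ⟩
    ∑Q α B (λ κ → ∑D (a ∷ κ) h)
      + (∑Q A β (λ κ → ∑D (b ∷ κ) h) + ∑Q α β (λ κ → ∑D ((a +⁺ b) ∷ κ) h))
      ≈⟨ +-cong (split α B a) (+-cong (split A β b) (split α β (a +⁺ b))) ⟩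
    (∑Q α B (λ κ → h [] (a ∷ κ)) + ∑Q-∑D α B hₐ)
      + ((∑Q A β (λ κ → h [] (b ∷ κ)) + ∑Q-∑D A β hᵇ)
      + (∑Q α β (λ κ → h [] ((a +⁺ b) ∷ κ)) + ∑Q-∑D α β hₐᵇ))
      ≈⟨ solve 6 (λ x₁ x₂ y₁ y₂ z₁ z₂ → (x₁ ⊕ x₂) ⊕ ((y₁ ⊕ y₂) ⊕ (z₁ ⊕ z₂))
           ⊜ (x₁ ⊕ (y₁ ⊕ z₁)) ⊕ (x₂ ⊕ (y₂ ⊕ z₂))) ≈-refl _ _ _ _ _ _ ⟩
    (∑Q α B (λ κ → h [] (a ∷ κ)) + (∑Q A β (λ κ → h [] (b ∷ κ)) + ∑Q α β (λ κ → h [] ((a +⁺ b) ∷ κ))))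
      + (∑Q-∑D α B hₐ + (∑Q-∑D A β hᵇ + ∑Q-∑D α β hₐᵇ))
      ≈⟨ +-cong (≈-sym (∑Q-∷ a α b β (h []))) (+-cong (deconcatenation-quasiShuffle α B hₐ)
           (+-cong (deconcatenation-quasiShuffle A β hᵇ) (deconcatenation-quasiShuffle α β hₐᵇ))) ⟩
    ∑Q A B (h []) + (∑D-∑Q α B hₐ + (∑D-∑Q A β hᵇ + ∑D-∑Q α β hₐᵇ))
      ≈⟨ +-congˡ (+-cong first (+-congʳ second)) ⟩
    ∑Q A B (h []) + ((X + X′) + ((Y + Y′) + ∑D-∑Q α β hₐᵇ))
      ≈⟨ solve 6 (λ w x x′ y y′ z → w ⊕ ((x ⊕ x′) ⊕ ((y ⊕ y′) ⊕ z))
           ⊜ (w ⊕ y) ⊕ (x ⊕ (x′ ⊕ (y′ ⊕ z)))) ≈-refl _ _ _ _ _ _ ⟩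
    (∑Q A B (h []) + Y) + (X + (X′ + (Y′ + ∑D-∑Q α β hₐᵇ)))
      ≈⟨ +-congˡ (+-congˡ third) ⟩
    (∑Q A B (h []) + Y) + (X + ∑D α (λ α₁ α₂ → ∑D β λ β₁ β₂ → T (a ∷ α₁) α₂ (b ∷ β₁) β₂))
      ≈⟨ +-congˡ (∑D-+ α _ _) ⟨
    (∑Q A B (h []) + Y) + ∑D α (λ α₁ α₂ → T (a ∷ α₁) α₂ [] B + ∑D β λ β₁ β₂ → T (a ∷ α₁) α₂ (b ∷ β₁) β₂)
      ≈⟨ +-cong (+-cong (∑Q-[]ˡ [] λ κ → ∑Q A B (h κ)) (∑D-cong β λ β₁ β₂ → ≈-refl)) (∑D-cong α λ α₁ α₂ → ∑D-∷ b β _) ⟨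
    (T [] A [] B + Y) + ∑D α (λ α₁ α₂ → ∑D B (T (a ∷ α₁) α₂))
      ≈⟨ +-congʳ (∑D-∷ b β (T [] A)) ⟨
    ∑D B (T [] A) + ∑D α (λ α₁ α₂ → ∑D B (T (a ∷ α₁) α₂))
      ≈⟨ ∑D-∷ a α _ ⟨
    ∑D-∑Q A B h ∎
    where
    open +-Solver
    hₐ hᵇ hₐᵇ : Functional₂
    hₐ  = h ∘ (a ∷_)
    hᵇ  = h ∘ (b ∷_)
    hₐᵇ = h ∘ ((a +⁺ b) ∷_)

    T : Composition → Composition → Composition → Composition → Carrier
    T α₁ α₂ β₁ β₂ = ∑Q α₁ β₁ λ κ → ∑Q α₂ β₂ (h κ)

    -- In `X` and `Y` the left piece takes nothing from `B`, respectively from `A`. In `X′` and `Y′`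
    -- it takes parts of both and begins with `a`, respectively `b`; together with the case `a +⁺ b`
    -- these are the three clauses for the quasi-shuffles of `a ∷ α₁` and `b ∷ β₁`.
    X X′ Y Y′ : Carrier
    X  = ∑D α λ α₁ α₂ → T (a ∷ α₁) α₂ [] B
    X′ = ∑D α λ α₁ α₂ → ∑D β λ β₁ β₂ → ∑Q α₁ (b ∷ β₁) λ κ → ∑Q α₂ β₂ (hₐ κ)
    Y  = ∑D β λ β₁ β₂ → T [] A (b ∷ β₁) β₂
    Y′ = ∑D α λ α₁ α₂ → ∑D β λ β₁ β₂ → ∑Q (a ∷ α₁) β₁ λ κ → ∑Q α₂ β₂ (hᵇ κ)

    split : ∀ α β e → ∑Q α β (λ κ → ∑D (e ∷ κ) h) ≈
            ∑Q α β (λ κ → h [] (e ∷ κ)) + ∑Q-∑D α β (h ∘ (e ∷_))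
    split α β e = ≈-trans (∑Q-cong α β λ κ → ∑D-∷ e κ h) (∑-∙ (quasiShuffle α β) _ _)

    first : ∑D-∑Q α B hₐ ≈ X + X′
    first = ≈-trans
      (∑D-cong α λ α₁ α₂ → ≈-trans (∑D-∷ b β _) (+-congʳ (≈-trans
        (∑Q-[]ʳ α₁ λ κ → ∑Q α₂ B (hₐ κ)) (≈-sym (∑Q-[]ʳ (a ∷ α₁) λ κ → ∑Q α₂ B (h κ))))))
      (∑D-+ α _ _)

    second : ∑D-∑Q A β hᵇ ≈ Y + Y′
    second = ≈-trans (∑D-∷ a α _) (+-congʳ (∑D-cong β λ β₁ β₂ → ≈-trans
      (∑Q-[]ˡ β₁ λ κ → ∑Q A β₂ (hᵇ κ)) (≈-sym (∑Q-[]ˡ (b ∷ β₁) λ κ → ∑Q A β₂ (h κ)))))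

    third : X′ + (Y′ + ∑D-∑Q α β hₐᵇ) ≈
            ∑D α λ α₁ α₂ → ∑D β λ β₁ β₂ → T (a ∷ α₁) α₂ (b ∷ β₁) β₂
    third = ≈-sym (≈-trans
      (∑D-cong α λ α₁ α₂ → ≈-trans
        (∑D-cong β λ β₁ β₂ → ∑Q-∷ a α₁ b β₁ λ κ → ∑Q α₂ β₂ (h κ))
        (≈-trans (∑D-+ β _ _) (+-congˡ (∑D-+ β _ _))))
      (≈-trans (∑D-+ α _ _) (+-congˡ (∑D-+ α _ _))))

  ∑D-assoc : ∀ α (f : Composition → Composition → Composition → Carrier) →
    ∑D α (λ β κ → ∑D κ λ γ δ → f β γ δ) ≈ ∑D α λ κ δ → ∑D κ λ β γ → f β γ δ
  ∑D-assoc [] f = ≈-refl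
  ∑D-assoc (a ∷ α) f = begin
    ∑D (a ∷ α) (λ β κ → ∑D κ (f β))
      ≈⟨ ∑D-∷ a α _ ⟩
    ∑D (a ∷ α) (f []) + ∑D α (λ β κ → ∑D κ (f (a ∷ β)))
      ≈⟨ +-cong (∑D-∷ a α (f [])) (∑D-assoc α (f ∘ (a ∷_))) ⟩
    (f [] [] (a ∷ α) + ∑D α (λ κ δ → f [] (a ∷ κ) δ)) + ∑D α (λ κ δ → ∑D κ λ β γ → f (a ∷ β) γ δ)
      ≈⟨ +-assoc _ _ _ ⟩
    f [] [] (a ∷ α) + (∑D α (λ κ δ → f [] (a ∷ κ) δ) + ∑D α (λ κ δ → ∑D κ λ β γ → f (a ∷ β) γ δ))
      ≈⟨ +-congˡ (∑D-+ α _ _) ⟨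
    f [] [] (a ∷ α) + ∑D α (λ κ δ → f [] (a ∷ κ) δ + ∑D κ λ β γ → f (a ∷ β) γ δ)
      ≈⟨ +-cong (+-identityʳ _) (∑D-cong α λ κ δ → ∑D-∷ a κ λ β γ → f β γ δ) ⟨
    ∑D [] (λ β γ → f β γ (a ∷ α)) + ∑D α (λ κ δ → ∑D (a ∷ κ) λ β γ → f β γ δ)
      ≈⟨ ∑D-∷ a α _ ⟨
    ∑D (a ∷ α) (λ κ δ → ∑D κ λ β γ → f β γ δ) ∎

  -- Products

  ∑-++-fold : (g : I → List J) (is : List I) (f : J → Carrier) →
              ∑ (foldr (λ i s → g i ++ s) [] is) f ≈ ∑ is λ i → ∑ (g i) f
  ∑-++-fold g []       f = ≈-refl
  ∑-++-fold g (i ∷ is) f = ≈-trans (∑-++ (g i) _ f) (+-congˡ (∑-++-fold g is f))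

  module _ (p : Composition → Composition → List Composition) where
    private module A = RawAlgebra (spannedBy p)

    eval-* : ∀ x y f → eval (x A.* y) f ≈ eval x λ α → eval y λ β → ∑ (p α β) f
    eval-* x y f = begin
      eval (x A.* y) f
        ≈⟨ ∑-concat (cartesianProductWith _ x y) _ ⟩
      ∑ (cartesianProductWith _ x y) (λ z → eval z f)
        ≈⟨ ∑-cartesianProductWith _ x y _ ⟩
      ∑ x (λ (r , α) → ∑ y λ (s , β) → eval (map (r * s ,_) (p α β)) f)
        ≈⟨ ∑-cong x (λ (r , α) → ∑-cong y λ (s , β) → ≈-trans
             (reflexive (∑-map (r * s ,_) (p α β) _))
             (≈-trans (≈-sym (*-distribˡ-∑ (r * s) (p α β) f)) (*-assoc _ _ _))) ⟩
      ∑ x (λ (r , α) → ∑ y λ (s , β) → r * (s * ∑ (p α β) f))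
        ≈⟨ ∑-cong x (λ (r , α) → *-distribˡ-∑ r y _) ⟨
      eval x (λ α → eval y λ β → ∑ (p α β) f) ∎

  module _ (p q : Composition → Composition → List Composition) where
    private
      module A   = RawAlgebra (spannedBy p)
      module B   = RawAlgebra (spannedBy q)
      module A⊗B = RawAlgebra (spannedBy p ⊗ᴬ spannedBy q)

    eval₂-* : ∀ t u f → eval₂ (t A⊗B.* u) f ≈
      eval₂ t λ α α′ → eval₂ u λ β β′ → ∑ (p α β) λ γ → ∑ (q α′ β′) (f γ)
    eval₂-* t u f = begin
      eval₂ (t A⊗B.* u) f
        ≈⟨ ∑-cartesianProductWith _ t u _ ⟩
      ∑ t (λ (x , x′) → ∑ u λ (y , y′) → eval (x A.* y) λ γ → eval (x′ B.* y′) (f γ))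
        ≈⟨ ∑-cong t (λ (x , x′) → ≈-trans (∑-cong u λ (y , y′) → pure x x′ y y′)
             (≈-sym (≈-trans (eval-cong x λ α → eval-∑ x′ u _) (eval-∑ x u _)))) ⟩
      eval₂ t (λ α α′ → eval₂ u λ β β′ → ∑ (p α β) λ γ → ∑ (q α′ β′) (f γ)) ∎
      where
      pure : ∀ x x′ y y′ → eval (x A.* y) (λ γ → eval (x′ B.* y′) (f γ)) ≈
        eval x λ α → eval x′ λ α′ → eval y λ β → eval y′ λ β′ → ∑ (p α β) λ γ → ∑ (q α′ β′) (f γ)
      pure x x′ y y′ = begin
        eval (x A.* y) (λ γ → eval (x′ B.* y′) (f γ))
          ≈⟨ eval-* p x y _ ⟩
        eval x (λ α → eval y λ β → ∑ (p α β) λ γ → eval (x′ B.* y′) (f γ))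
          ≈⟨ eval-cong x (λ α → eval-cong y λ β → ∑-cong (p α β) λ γ → eval-* q x′ y′ (f γ)) ⟩
        eval x (λ α → eval y λ β → ∑ (p α β) λ γ → eval x′ λ α′ → eval y′ λ β′ → ∑ (q α′ β′) (f γ))
          ≈⟨ eval-cong x (λ α → eval-cong y λ β → ≈-trans
               (≈-sym (eval-∑ x′ (p α β) _)) (eval-cong x′ λ α′ → ≈-sym (eval-∑ y′ (p α β) _))) ⟩
        eval x (λ α → eval y λ β → eval x′ λ α′ → eval y′ λ β′ → ∑ (p α β) λ γ → ∑ (q α′ β′) (f γ))
          ≈⟨ eval-cong x (λ α → eval-swap y x′ _) ⟩
        eval x (λ α → eval x′ λ α′ → eval y λ β → eval y′ λ β′ → ∑ (p α β) λ γ → ∑ (q α′ β′) (f γ)) ∎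

  -- Homogeneous components

  ∑-filter : ∀ {p} {P : I → Set p} (P? : ∀ i → Dec (P i)) (is : List I) (f : I → Carrier) →
             ∑ (filter P? is) f ≈ ∑ is λ i → ⟦ P? i ⟧ * f i
  ∑-filter P? []       f = ≈-refl
  ∑-filter P? (i ∷ is) f with P? i
  ... | yes _ = +-cong (≈-sym (*-identityˡ _)) (∑-filter P? is f)
  ... | no _  = ≈-trans (∑-filter P? is f) (≈-sym (≈-trans (+-congʳ (zeroˡ _)) (+-identityˡ _)))

  eval-component : ∀ n x f → eval (component n x) f ≈ eval x λ α → ⟦ ∣ α ∣ ℕ.≟ n ⟧ * f α
  eval-component n x f = ≈-trans (∑-filter (λ (_ , α) → ∣ α ∣ ℕ.≟ n) x _)
    (∑-cong x λ _ → x*yz≈y*xz _ _ _)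

  -- For `a ≤ n` only `i = a` survives, and `n ∸ a` is a true difference; for larger `a` no index in
  -- the range equals `a`. All splittings of a degree reduce to this: in total components, in the
  -- coproduct of a letter H, and in the product of series.
  ∑-⟦⟧-convolution : ∀ a b n →
    ∑ (upTo (suc n)) (λ i → ⟦ a ℕ.≟ i ⟧ * ⟦ b ℕ.≟ n ∸ i ⟧) ≈ ⟦ a ℕ.+ b ℕ.≟ n ⟧
  ∑-⟦⟧-convolution a b n with a ℕ.≤? n
  ... | yes a≤n = ≈-trans
    (∑-select (Unique.upTo⁺ (suc n)) (∈-upTo⁺ (s≤s a≤n)) (a ℕ.≟_) _)
    (⟦⟧-⇔ (b ℕ.≟ n ∸ a) (a ℕ.+ b ℕ.≟ n)
      (λ { refl → ℕ.m+[n∸m]≡n a≤n }) (λ { refl → ≡.sym (ℕ.m+n∸m≡n a b) }))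
  ... | no a≰n = ≈-trans
    (∑-ε (upTo (suc n)) λ {i} i∈ → ≈-trans (*-congʳ (⟦⟧-false (a ℕ.≟ i)
      λ { refl → a≰n (ℕ.s≤s⁻¹ (∈-upTo⁻ i∈)) })) (zeroˡ _))
    (≈-sym (⟦⟧-false (a ℕ.+ b ℕ.≟ n) λ { refl → a≰n (ℕ.m≤m+n a b) }))

  eval₂-totalComponent : ∀ n t f →
    eval₂ (totalComponent n t) f ≈ eval₂ t λ α β → ⟦ ∣ α ∣ ℕ.+ ∣ β ∣ ℕ.≟ n ⟧ * f α β
  eval₂-totalComponent n t f = ≈-trans (∑-concatMap _ t _) (∑-cong t λ (x , y) → pure x y)
    where
    pure : ∀ x y →
      eval₂ (map (λ i → component i x , component (n ∸ i) y) (upTo (suc n))) f ≈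
      eval x λ α → eval y λ β → ⟦ ∣ α ∣ ℕ.+ ∣ β ∣ ℕ.≟ n ⟧ * f α β
    pure x y = begin
      eval₂ (map (λ i → component i x , component (n ∸ i) y) (upTo (suc n))) f
        ≡⟨ ∑-map _ (upTo (suc n)) _ ⟩
      ∑ (upTo (suc n)) (λ i → eval (component i x) λ α → eval (component (n ∸ i) y) (f α))
        ≈⟨ ∑-cong (upTo (suc n)) (λ i → ≈-trans (eval-component i x _) (eval-cong x λ α → ≈-trans
             (*-congˡ (eval-component (n ∸ i) y (f α))) (≈-sym (eval-*ˡ y _ _)))) ⟩
      ∑ (upTo (suc n)) (λ i → eval x λ α → eval y λ β →
        ⟦ ∣ α ∣ ℕ.≟ i ⟧ * (⟦ ∣ β ∣ ℕ.≟ n ∸ i ⟧ * f α β))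
        ≈⟨ ≈-trans (eval-cong x λ α → eval-∑ y (upTo (suc n)) _) (eval-∑ x (upTo (suc n)) _) ⟨
      eval x (λ α → eval y λ β → ∑ (upTo (suc n)) λ i →
        ⟦ ∣ α ∣ ℕ.≟ i ⟧ * (⟦ ∣ β ∣ ℕ.≟ n ∸ i ⟧ * f α β))
        ≈⟨ eval-cong x (λ α → eval-cong y λ β → ≈-trans
             (∑-cong (upTo (suc n)) λ i → ≈-trans (≈-sym (*-assoc _ _ _)) (*-comm _ (f α β)))
             (≈-trans (≈-sym (*-distribˡ-∑ (f α β) (upTo (suc n)) _)) (≈-trans (*-comm (f α β) _)
               (*-congʳ (∑-⟦⟧-convolution (∣ α ∣) (∣ β ∣) n))))) ⟩
      eval x (λ α → eval y λ β → ⟦ ∣ α ∣ ℕ.+ ∣ β ∣ ℕ.≟ n ⟧ * f α β) ∎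

  eval₂-∑⊗ : ∀ (is : List I) (x y : I → Combination) f g →
    eval₂ (foldr (λ i t → (x i ⊗ y i) ++ t) [] is) (λ α β → f α * g β)
    ≈ ∑ is λ i → eval (x i) f * eval (y i) g
  eval₂-∑⊗ is x y f g = ≈-trans (∑-++-fold (λ i → x i ⊗ y i) is _)
    (∑-cong is λ i → eval₂-⊗-* (x i) (y i) f g)

  -- The coproducts

  private
    concatenation : Composition → Composition → List Composition
    concatenation α β = (α ++ β) ∷ []

  Δ-H : ℕ → ⟪ NSym ⊗ᴬ NSym ⟫
  Δ-H r = N⊗N.∑ (upTo (suc r)) λ i → H i ⊗ H (r ∸ i)

  -- The coproduct of H_γ. It agrees definitionally with the function that `Δ` extends linearly,
  -- whose local helper is repeated in `Δ-H`.
  Δ-Hᶜ : Composition → ⟪ NSym ⊗ᴬ NSym ⟫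
  Δ-Hᶜ = foldr (λ a t → Δ-H ⌊ a ⌋ N⊗N.* t) N⊗N.1#

  eval₂-Δ : ∀ x f → eval₂ (Δ x) f ≈ eval x λ γ → eval₂ (Δ-Hᶜ γ) f
  eval₂-Δ x f = ≈-trans (∑-++-fold _ x _) (∑-cong x λ (r , γ) → eval₂-scale r (Δ-Hᶜ γ) f)

  eval₂-Δ∨ : ∀ x f → eval₂ (Δ∨ x) f ≈ eval x λ κ → ∑D κ f
  eval₂-Δ∨ x f = ≈-trans (∑-++-fold _ x _) (∑-cong x λ (r , κ) → ≈-trans
    (eval₂-scale r (map (λ (β , γ) → basis β , basis γ) (deconcatenations κ)) f)
    (*-congˡ (≈-trans (reflexive (∑-map _ (deconcatenations κ) _)) (∑D-cong κ λ β γ →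
      ≈-trans (eval-basis β λ β′ → eval (basis γ) (f β′)) (eval-basis γ (f β))))))

  -- The index of H n in the basis.
  part : ℕ → Composition
  part zero    = []
  part (suc n) = (1+ n) ∷ []

  eval-H : ∀ n f → eval (H n) f ≈ f (part n)
  eval-H zero    f = eval-basis [] f
  eval-H (suc n) f = eval-basis ((1+ n) ∷ []) f

  eval₂-Δ-H-* : ∀ r t f → eval₂ (Δ-H r N⊗N.* t) f ≈
    ∑ (upTo (suc r)) λ i → eval₂ t λ α β → f (part i ++ α) (part (r ∸ i) ++ β)
  eval₂-Δ-H-* r t f = begin
    eval₂ (Δ-H r N⊗N.* t) f
      ≈⟨ eval₂-* concatenation concatenation (Δ-H r) t f ⟩
    eval₂ (Δ-H r) (λ α α′ → eval₂ t λ β β′ → f (α ++ β) (α′ ++ β′) + 0# + 0#)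
      ≈⟨ eval₂-cong (Δ-H r) (λ α α′ → eval₂-cong t λ β β′ →
           ≈-trans (+-identityʳ _) (+-identityʳ _)) ⟩
    eval₂ (Δ-H r) (λ α α′ → eval₂ t λ β β′ → f (α ++ β) (α′ ++ β′))
      ≈⟨ ∑-++-fold (λ i → H i ⊗ H (r ∸ i)) (upTo (suc r)) _ ⟩
    ∑ (upTo (suc r)) (λ i → eval₂ (H i ⊗ H (r ∸ i)) λ α α′ → eval₂ t λ β β′ → f (α ++ β) (α′ ++ β′))
      ≈⟨ ∑-cong (upTo (suc r)) (λ i → ≈-trans (eval₂-⊗ (H i) (H (r ∸ i)) _)
           (≈-trans (eval-H i _) (eval-H (r ∸ i) _))) ⟩
    ∑ (upTo (suc r)) (λ i → eval₂ t λ α β → f (part i ++ α) (part (r ∸ i) ++ β)) ∎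

  -- All (i , β) with part i ++ β ≡ α.
  strips : Composition → List (ℕ × Composition)
  strips []      = (0 , []) ∷ []
  strips (a ∷ α) = (0 , a ∷ α) ∷ (⌊ a ⌋ , α) ∷ []

  δ-∷ : ∀ a α b β → δ (a ∷ α) (b ∷ β) ≈ ⟦ ⌊ b ⌋ ℕ.≟ ⌊ a ⌋ ⟧ * δ α β
  δ-∷ a α b β = ≈-sym (⟦⟧-× (⌊ b ⌋ ℕ.≟ ⌊ a ⌋) (α ≟ᶜ β) ((a ∷ α) ≟ᶜ (b ∷ β))
    (λ { refl refl → refl }) (λ { refl → refl }) (λ { refl → refl }))

  δ-part : ∀ i α β → δ (part i ++ β) α ≈ ∑ (strips α) λ (j , α′) → ⟦ j ℕ.≟ i ⟧ * δ β α′
  δ-part zero []      β = ≈-sym (≈-trans (+-identityʳ _) (*-identityˡ _))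
  δ-part zero (a ∷ α) β = ≈-sym (≈-trans
    (+-cong (*-identityˡ _) (≈-trans (+-identityʳ _) (zeroˡ _))) (+-identityʳ _))
  δ-part (suc i) []      β = ≈-sym (≈-trans (+-identityʳ _) (zeroˡ _))
  δ-part (suc i) (a ∷ α) β = ≈-sym (≈-trans (+-cong (zeroˡ _) (+-identityʳ _))
    (≈-trans (+-identityˡ _) (≈-sym (δ-∷ (1+ i) β a α))))

  -- The first letter splits as H_i ⊗ H_j with i + j = `⌊ a ⌋`. A term H_α ⊗ H_β arises by putting
  -- H_i and H_j in front, so both are stripped off again; index 0 strips nothing, as H_0 = 1.
  coefficient₂-Δ-Hᶜ-∷ : ∀ a γ α β → coefficient₂ (Δ-Hᶜ (a ∷ γ)) α β ≈
    ∑ (strips α) λ (i , α′) → ∑ (strips β) λ (j , β′) →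
    ⟦ i ℕ.+ j ℕ.≟ ⌊ a ⌋ ⟧ * coefficient₂ (Δ-Hᶜ γ) α′ β′
  coefficient₂-Δ-Hᶜ-∷ a γ α β = begin
    coefficient₂ (Δ-Hᶜ (a ∷ γ)) α β
      ≈⟨ eval₂-Δ-H-* n t _ ⟩
    ∑ ks (λ k → eval₂ t λ ε ζ → δ (part k ++ ε) α * δ (part (n ∸ k) ++ ζ) β)
      ≈⟨ ∑-cong ks (λ k → eval₂-cong t λ ε ζ → *-cong (δ-part k α ε) (δ-part (n ∸ k) β ζ)) ⟩
    ∑ ks (λ k → eval₂ t λ ε ζ →
      ∑ (strips α) (λ (i , α′) → ⟦ i ℕ.≟ k ⟧ * δ ε α′)
      * ∑ (strips β) (λ (j , β′) → ⟦ j ℕ.≟ n ∸ k ⟧ * δ ζ β′))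
      ≈⟨ ∑-cong ks (λ k → eval₂-cong t λ ε ζ → ∑-* (strips α) (strips β) _ _) ⟩
    ∑ ks (λ k → eval₂ t λ ε ζ → ∑ (strips α) λ (i , α′) → ∑ (strips β) λ (j , β′) →
      (⟦ i ℕ.≟ k ⟧ * δ ε α′) * (⟦ j ℕ.≟ n ∸ k ⟧ * δ ζ β′))
      ≈⟨ ∑-cong ks (λ k → ≈-trans (eval₂-∑ t (strips α) _) (∑-cong (strips α) λ (i , α′) →
           ≈-trans (eval₂-∑ t (strips β) _) (∑-cong (strips β) λ (j , β′) → ≈-trans
             (eval₂-cong t λ ε ζ → *-interchange _ _ _ _) (≈-trans (eval₂-*ˡ t _ _) (*-comm _ _))))) ⟩
    ∑ ks (λ k → ∑ (strips α) λ (i , α′) → ∑ (strips β) λ (j , β′) →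
      coefficient₂ t α′ β′ * (⟦ i ℕ.≟ k ⟧ * ⟦ j ℕ.≟ n ∸ k ⟧))
      ≈⟨ ≈-trans (∑-swap ks (strips α) _) (∑-cong (strips α) λ _ → ∑-swap ks (strips β) _) ⟩
    ∑ (strips α) (λ (i , α′) → ∑ (strips β) λ (j , β′) → ∑ ks λ k →
      coefficient₂ t α′ β′ * (⟦ i ℕ.≟ k ⟧ * ⟦ j ℕ.≟ n ∸ k ⟧))
      ≈⟨ ∑-cong (strips α) (λ (i , α′) → ∑-cong (strips β) λ (j , β′) →
           ≈-trans (≈-sym (*-distribˡ-∑ _ ks _)) (≈-trans (*-congˡ (∑-⟦⟧-convolution i j n)) (*-comm _ _))) ⟩
    ∑ (strips α) (λ (i , α′) → ∑ (strips β) λ (j , β′) → ⟦ i ℕ.+ j ℕ.≟ n ⟧ * coefficient₂ t α′ β′) ∎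
    where
    n : ℕ
    n = ⌊ a ⌋
    ks : List ℕ
    ks = upTo (suc n)
    t : ⟪ NSym ⊗ᴬ NSym ⟫
    t = Δ-Hᶜ γ
    ∑-* : ∀ {i j} {I : Set i} {J : Set j} (is : List I) (js : List J) f g →
          ∑ is f * ∑ js g ≈ ∑ is λ i → ∑ js λ j → f i * g j
    ∑-* is js f g = ≈-trans (*-comm _ _) (≈-trans (*-distribˡ-∑ _ is f) (∑-cong is λ i →
      ≈-trans (*-comm _ _) (*-distribˡ-∑ (f i) js g)))

  -- Of the four ways to strip `a ∷ α` and `b ∷ β`, stripping nothing from both is excluded because
  -- the letter `c` is positive. Stripping `b`, `a`, or both gives the three clauses of
  -- `quasiShuffle`, with first part `b`, `a` or `a +⁺ b`.
  Δ-quasiShuffle : ∀ γ α β → coefficient₂ (Δ-Hᶜ γ) α β ≈ ∑Q α β (δ γ)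
  Δ-quasiShuffle [] α β = ≈-trans (eval₂-⊗ (basis []) (basis []) (λ α′ β′ → δ α′ α * δ β′ β))
    (≈-trans (eval-basis [] λ α′ → eval (basis []) λ β′ → δ α′ α * δ β′ β)
    (≈-trans (eval-basis [] λ β′ → δ [] α * δ β′ β) (empty α β)))
    where
    empty : ∀ α β → δ [] α * δ [] β ≈ ∑Q α β (δ [])
    empty []      β       = ≈-trans (*-identityˡ _) (≈-sym (∑Q-[]ˡ β (δ [])))
    empty (a ∷ α) []      = ≈-trans (zeroˡ _) (≈-sym (∑Q-[]ʳ (a ∷ α) (δ [])))
    empty (a ∷ α) (b ∷ β) = ≈-trans (zeroˡ _) (≈-sym (≈-trans (∑Q-∷ a α b β (δ []))
      (≈-trans (+-cong (∑-ε (quasiShuffle α (b ∷ β)) λ _ → ≈-refl)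
        (+-cong (∑-ε (quasiShuffle (a ∷ α) β) λ _ → ≈-refl) (∑-ε (quasiShuffle α β) λ _ → ≈-refl)))
      (≈-trans (+-identityˡ _) (+-identityˡ _)))))
  -- Matching on `c` exposes `⌊ c ⌋` as a successor, so the indicator of `0 ≡ ⌊ c ⌋` computes to
  -- `0#`.
  Δ-quasiShuffle (c@(1+ _) ∷ γ) α β = ≈-trans (coefficient₂-Δ-Hᶜ-∷ c γ α β) (≈-trans
    (∑-cong (strips α) λ (i , α′) → ∑-cong (strips β) λ (j , β′) →
      *-congˡ (Δ-quasiShuffle γ α′ β′))
    (nonempty α β))
    where
    strip : ∀ e α β → ∑Q α β (λ κ → δ (c ∷ γ) (e ∷ κ)) ≈ ⟦ ⌊ e ⌋ ℕ.≟ ⌊ c ⌋ ⟧ * ∑Q α β (δ γ)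
    strip e α β = ≈-trans (∑Q-cong α β λ κ → δ-∷ c γ e κ)
      (≈-sym (*-distribˡ-∑ _ (quasiShuffle α β) (δ γ)))

    0+x+0 : ∀ x y → 0# * y + (x + 0#) ≈ x
    0+x+0 x y = ≈-trans (+-cong (zeroˡ y) (+-identityʳ x)) (+-identityˡ x)

    nonempty : ∀ α β → ∑ (strips α) (λ (i , α′) → ∑ (strips β) λ (j , β′) →
               ⟦ i ℕ.+ j ℕ.≟ ⌊ c ⌋ ⟧ * ∑Q α′ β′ (δ γ)) ≈ ∑Q α β (δ (c ∷ γ))
    nonempty [] [] = ≈-trans (+-identityʳ _) (≈-trans (+-identityʳ _) (≈-trans (zeroˡ _)
      (≈-sym (∑Q-[]ˡ [] (δ (c ∷ γ))))))
    nonempty [] (b ∷ β) = ≈-trans (+-identityʳ _) (≈-trans (0+x+0 _ _)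
      (≈-trans (≈-sym (strip b [] β))
      (≈-trans (∑Q-[]ˡ β λ κ → δ (c ∷ γ) (b ∷ κ)) (≈-sym (∑Q-[]ˡ (b ∷ β) (δ (c ∷ γ)))))))
    nonempty (a ∷ α) [] = ≈-trans (+-cong (+-identityʳ _) (≈-trans (+-identityʳ _)
        (≈-trans (+-identityʳ _) (*-congʳ (⟦⟧-⇔ (⌊ a ⌋ ℕ.+ 0 ℕ.≟ ⌊ c ⌋) (⌊ a ⌋ ℕ.≟ ⌊ c ⌋)
          (≡.trans (≡.sym (ℕ.+-identityʳ ⌊ a ⌋))) (≡.trans (ℕ.+-identityʳ ⌊ a ⌋)))))))
      (≈-trans (+-congʳ (zeroˡ _)) (≈-trans (+-identityˡ _) (≈-trans (≈-sym (strip a α []))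
      (≈-trans (∑Q-[]ʳ α _) (≈-sym (∑Q-[]ʳ (a ∷ α) (δ (c ∷ γ))))))))
    nonempty (a ∷ α) (b ∷ β) = begin
      (0# * _ + (⟦ ⌊ b ⌋ ℕ.≟ ⌊ c ⌋ ⟧ * ∑Q (a ∷ α) β (δ γ) + 0#))
        + ((⟦ ⌊ a ⌋ ℕ.+ 0 ℕ.≟ ⌊ c ⌋ ⟧ * ∑Q α (b ∷ β) (δ γ)
          + (⟦ ⌊ a ⌋ ℕ.+ ⌊ b ⌋ ℕ.≟ ⌊ c ⌋ ⟧ * ∑Q α β (δ γ) + 0#)) + 0#)
        ≈⟨ +-cong (0+x+0 _ _) (≈-trans (+-identityʳ _) (+-cong
             (*-congʳ (⟦⟧-⇔ (⌊ a ⌋ ℕ.+ 0 ℕ.≟ ⌊ c ⌋) (⌊ a ⌋ ℕ.≟ ⌊ c ⌋)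
               (≡.trans (≡.sym (ℕ.+-identityʳ ⌊ a ⌋))) (≡.trans (ℕ.+-identityʳ ⌊ a ⌋))))
             (≈-trans (+-identityʳ _) (*-congʳ (⟦⟧-⇔ (⌊ a ⌋ ℕ.+ ⌊ b ⌋ ℕ.≟ ⌊ c ⌋) (⌊ a +⁺ b ⌋ ℕ.≟ ⌊ c ⌋)
               (≡.trans (⌊⌋-+⁺ a b)) (≡.trans (≡.sym (⌊⌋-+⁺ a b)))))))) ⟩
      ⟦ ⌊ b ⌋ ℕ.≟ ⌊ c ⌋ ⟧ * ∑Q (a ∷ α) β (δ γ)
        + (⟦ ⌊ a ⌋ ℕ.≟ ⌊ c ⌋ ⟧ * ∑Q α (b ∷ β) (δ γ) + ⟦ ⌊ a +⁺ b ⌋ ℕ.≟ ⌊ c ⌋ ⟧ * ∑Q α β (δ γ))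
        ≈⟨ +-cong (strip b (a ∷ α) β) (+-cong (strip a α (b ∷ β)) (strip (a +⁺ b) α β)) ⟨
      ∑Q (a ∷ α) β (λ κ → δ (c ∷ γ) (b ∷ κ))
        + (∑Q α (b ∷ β) (λ κ → δ (c ∷ γ) (a ∷ κ)) + ∑Q α β (λ κ → δ (c ∷ γ) ((a +⁺ b) ∷ κ)))
        ≈⟨ x+yz≈y+xz _ _ _ ⟩
      ∑Q α (b ∷ β) (λ κ → δ (c ∷ γ) (a ∷ κ))
        + (∑Q (a ∷ α) β (λ κ → δ (c ∷ γ) (b ∷ κ)) + ∑Q α β (λ κ → δ (c ∷ γ) ((a +⁺ b) ∷ κ)))
        ≈⟨ ∑Q-∷ a α b β (δ (c ∷ γ)) ⟨
      ∑Q (a ∷ α) (b ∷ β) (δ (c ∷ γ)) ∎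

  coefficient₂-Δ : ∀ x α β → coefficient₂ (Δ x) α β ≈ ∑Q α β (coefficient x)
  coefficient₂-Δ x α β = ≈-trans (eval₂-Δ x _) (≈-trans
    (eval-cong x λ γ → Δ-quasiShuffle γ α β) (eval-∑ x (quasiShuffle α β) δ))

  -- The antipode

  module _ {S∨ : ⟪ QSym ⟫ → ⟪ QSym ⟫} (isAntipode : IsAntipode S∨) where
    open IsAntipode isAntipode
    open LeftModuleMorphisms.IsLeftModuleHomomorphism isLinear

    eval-S∨ : ∀ x h → eval (S∨ x) h ≈ eval x λ β → eval (S∨ (basis β)) h
    eval-S∨ [] h = eval-≋ {S∨ []} {[]} 0ᴹ-homo h
    eval-S∨ ((r , β) ∷ x) h = begin
      eval (S∨ ((r , β) ∷ x)) h
        ≈⟨ eval-≋ {S∨ ((r , β) ∷ x)} {S∨ ((r Q.∙ basis β) ++ x)}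
             (⟦⟧-cong λ γ → +-congʳ (*-congʳ (≈-sym (*-identityʳ r)))) h ⟩
      eval (S∨ ((r Q.∙ basis β) ++ x)) h
        ≈⟨ eval-≋ {S∨ ((r Q.∙ basis β) ++ x)} {S∨ (r Q.∙ basis β) ++ S∨ x}
             (+ᴹ-homo (r Q.∙ basis β) x) h ⟩
      eval (S∨ (r Q.∙ basis β) ++ S∨ x) h
        ≈⟨ ∑-++ (S∨ (r Q.∙ basis β)) (S∨ x) _ ⟩
      eval (S∨ (r Q.∙ basis β)) h + eval (S∨ x) h
        ≈⟨ +-cong (≈-trans (eval-≋ {S∨ (r Q.∙ basis β)} {r Q.∙ S∨ (basis β)} (*ₗ-homo r (basis β)) h)
                           (eval-scale r (S∨ (basis β)) h))
                  (eval-S∨ x h) ⟩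
      r * eval (S∨ (basis β)) h + eval x (λ β → eval (S∨ (basis β)) h) ∎

    -- The convolution of `S∨` and the identity is the counit followed by the unit. The test
    -- function is arbitrary because the final cancellation takes for `h` a multiplication by
    -- another M followed by the extraction of a coefficient.
    antipode-inverseˡ : ∀ x h →
      eval x (λ κ → ∑D κ λ β γ → eval (S∨ (basis β)) λ σ → ∑Q σ γ h) ≈ coefficient x [] * h []
    antipode-inverseˡ x h = begin
      eval x (λ κ → ∑D κ Ψ)
        ≈⟨ eval₂-Δ∨ x Ψ ⟨
      eval₂ (Δ∨ x) Ψ
        ≈⟨ ∑-cong (Δ∨ x) (λ (y , z) → ≈-trans (eval-cong y λ β → eval-swap z (S∨ (basis β)) _)
             (≈-sym (eval-S∨ y λ σ → eval z λ γ → ∑Q σ γ h))) ⟩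
      ∑ (Δ∨ x) (λ (y , z) → eval (S∨ y) λ σ → eval z λ γ → ∑Q σ γ h)
        ≈⟨ ∑-cong (Δ∨ x) (λ (y , z) → eval-* quasiShuffle (S∨ y) z h) ⟨
      ∑ (Δ∨ x) (λ (y , z) → eval (S∨ y Q.* z) h)
        ≡⟨ ∑-map _ (Δ∨ x) _ ⟨
      ∑ ((S∨ ⊗₁ id) (Δ∨ x)) (λ (y , z) → eval (y Q.* z) h)
        ≈⟨ ∑-++-fold (uncurry Q._*_) ((S∨ ⊗₁ id) (Δ∨ x)) _ ⟨
      eval (multiply QSym ((S∨ ⊗₁ id) (Δ∨ x))) h
        ≈⟨ eval-≋ {multiply QSym ((S∨ ⊗₁ id) (Δ∨ x))} {ε∨ x Q.∙ Q.1#} (inverseˡ x) h ⟩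
      eval (ε∨ x Q.∙ Q.1#) h
        ≈⟨ ≈-trans (eval-scale (ε∨ x) Q.1# h) (*-congˡ (eval-basis [] h)) ⟩
      coefficient x [] * h [] ∎
      where
      Ψ : Functional₂
      Ψ β γ = eval (S∨ (basis β)) λ σ → ∑Q σ γ h

  -- Concatenation in NSym is dual to deconcatenation: (β , γ) is a cut of `β ++ γ` alone, and
  -- occurs there once.
  ∑D-δ : ∀ β γ α → ∑D α (λ β′ γ′ → δ γ γ′ * δ β′ β) ≈ δ (β ++ γ) α
  ∑D-δ []      γ []      = ≈-trans (+-identityʳ _) (*-identityʳ _)
  ∑D-δ (b ∷ β) γ []      = ≈-trans (+-identityʳ _) (zeroʳ _)
  ∑D-δ []      γ (a ∷ α) = ≈-trans (∑D-∷ a α _) (≈-trans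
    (+-cong (*-identityʳ _) (∑-ε (deconcatenations α) λ _ → zeroʳ _)) (+-identityʳ _))
  ∑D-δ (b ∷ β) γ (a ∷ α) = begin
    ∑D (a ∷ α) (λ β′ γ′ → δ γ γ′ * δ β′ (b ∷ β))
      ≈⟨ ∑D-∷ a α _ ⟩
    δ γ (a ∷ α) * 0# + ∑D α (λ β′ γ′ → δ γ γ′ * δ (a ∷ β′) (b ∷ β))
      ≈⟨ +-cong (zeroʳ _) (∑D-cong α λ β′ γ′ → ≈-trans (*-congˡ (δ-∷ a β′ b β)) (x*yz≈y*xz _ _ _)) ⟩
    0# + ∑D α (λ β′ γ′ → ⟦ ⌊ b ⌋ ℕ.≟ ⌊ a ⌋ ⟧ * (δ γ γ′ * δ β′ β))
      ≈⟨ ≈-trans (+-identityˡ _) (≈-sym (*-distribˡ-∑ _ (deconcatenations α) _)) ⟩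
    ⟦ ⌊ b ⌋ ℕ.≟ ⌊ a ⌋ ⟧ * ∑D α (λ β′ γ′ → δ γ γ′ * δ β′ β)
      ≈⟨ *-cong (⟦⟧-⇔ (⌊ b ⌋ ℕ.≟ ⌊ a ⌋) (⌊ a ⌋ ℕ.≟ ⌊ b ⌋) ≡.sym ≡.sym) (∑D-δ β γ α) ⟩
    ⟦ ⌊ a ⌋ ℕ.≟ ⌊ b ⌋ ⟧ * δ (β ++ γ) α
      ≈⟨ δ-∷ b (β ++ γ) a α ⟨
    δ (b ∷ (β ++ γ)) (a ∷ α) ∎

  ∑D-coefficient : ∀ x β α →
    ∑D α (λ β′ γ → coefficient x γ * δ β′ β) ≈ eval x λ γ → δ (β ++ γ) α
  ∑D-coefficient x β α = begin
    ∑D α (λ β′ γ → coefficient x γ * δ β′ β)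
      ≈⟨ ∑D-cong α (λ β′ γ → ≈-sym (eval-*ʳ x (δ β′ β) λ γ′ → δ γ′ γ)) ⟩
    ∑D α (λ β′ γ → eval x λ γ′ → δ γ′ γ * δ β′ β)
      ≈⟨ eval-∑ x (deconcatenations α) _ ⟨
    eval x (λ γ′ → ∑D α λ β′ γ → δ γ′ γ * δ β′ β)
      ≈⟨ eval-cong x (λ γ′ → ∑D-δ β γ′ α) ⟩
    eval x (λ γ′ → δ (β ++ γ′) α) ∎

  ++-∣∣ : ∀ α β → ∣ α ++ β ∣ ≡ ∣ α ∣ ℕ.+ ∣ β ∣
  ++-∣∣ []      β = refl
  ++-∣∣ (a ∷ α) β = ≡.trans (≡.cong (⌊ a ⌋ ℕ.+_) (++-∣∣ α β)) (≡.sym (ℕ.+-assoc ⌊ a ⌋ _ _))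

  -- The kernel ∑ H_γ ⊗ M_γ

  coefficient₂-totalComponent : ∀ n t α β →
    coefficient₂ (totalComponent n t) α β ≈ ⟦ ∣ α ∣ ℕ.+ ∣ β ∣ ℕ.≟ n ⟧ * coefficient₂ t α β
  coefficient₂-totalComponent n t α β = ≈-trans (eval₂-totalComponent n t _) (≈-trans
    (eval₂-cong t λ α′ β′ → begin
      ⟦ ∣ α′ ∣ ℕ.+ ∣ β′ ∣ ℕ.≟ n ⟧ * (δ α′ α * δ β′ β)
        ≈⟨ ≈-trans (x*yz≈y*xz _ _ _) (*-congˡ (*-comm _ _)) ⟩
      δ α′ α * (δ β′ β * ⟦ ∣ α′ ∣ ℕ.+ ∣ β′ ∣ ℕ.≟ n ⟧)
        ≈⟨ ⟦⟧-*-cong (α′ ≟ᶜ α) (λ { refl → ⟦⟧-*-cong (β′ ≟ᶜ β) λ { refl → ≈-refl } }) ⟩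
      δ α′ α * (δ β′ β * ⟦ ∣ α ∣ ℕ.+ ∣ β ∣ ℕ.≟ n ⟧)
        ≈⟨ ≈-trans (x*yz≈y*xz _ _ _) (*-congˡ (*-comm _ _)) ⟨
      ⟦ ∣ α ∣ ℕ.+ ∣ β ∣ ℕ.≟ n ⟧ * (δ α′ α * δ β′ β) ∎)
    (eval₂-*ˡ t _ _))

  -- H_γ ⊗ M_γ has total degree twice |γ|, so the odd components vanish, and the sum up to size `n`
  -- contains all that component `n` needs.
  kernel : Series
  kernel n = totalComponent n (N⊗Q.∑≤ n λ γ → basis γ ⊗ basis γ)

  eval₂-kernel : ∀ n f →
    eval₂ (kernel n) f ≈ ∑≤ n λ γ → ⟦ ∣ γ ∣ ℕ.+ ∣ γ ∣ ℕ.≟ n ⟧ * f γ γ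
  eval₂-kernel n f = ≈-trans (eval₂-totalComponent n (N⊗Q.∑≤ n λ γ → basis γ ⊗ basis γ) f) (≈-trans
    (∑-++-fold (λ γ → basis γ ⊗ basis γ) (compositions≤ n) _)
    (∑-cong (compositions≤ n) λ γ → ≈-trans 
      (eval₂-⊗ (basis γ) (basis γ) λ α β → ⟦ ∣ α ∣ ℕ.+ ∣ β ∣ ℕ.≟ n ⟧ * f α β)
      (≈-trans (eval-basis γ λ α → eval (basis γ) λ β → ⟦ ∣ α ∣ ℕ.+ ∣ β ∣ ℕ.≟ n ⟧ * f α β)
               (eval-basis γ λ β → ⟦ ∣ γ ∣ ℕ.+ ∣ β ∣ ℕ.≟ n ⟧ * f γ β))))

  eval₂-kernel-δ : ∀ n κ (Y : Composition → Carrier) →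
    eval₂ (kernel n) (λ α β → Y α * δ β κ) ≈ ⟦ ∣ κ ∣ ℕ.+ ∣ κ ∣ ℕ.≟ n ⟧ * Y κ
  eval₂-kernel-δ n κ Y = ≈-trans (eval₂-kernel n λ α β → Y α * δ β κ) (≈-trans
    (∑-cong (compositions≤ n) λ γ → ≈-trans (≈-sym (*-assoc _ _ _))
      (≈-trans (*-comm _ _) (*-congʳ (δ-sym γ κ))))
    collapse)
    where
    Z : Composition → Carrier
    Z γ = ⟦ ∣ γ ∣ ℕ.+ ∣ γ ∣ ℕ.≟ n ⟧ * Y γ

    collapse : ∑≤ n (λ γ → δ κ γ * Z γ) ≈ Z κ
    collapse with ∣ κ ∣ ℕ.≤? n
    ... | yes κ≤n = ∑≤-δ {n} {κ} κ≤n Z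
    -- Here `κ` lies outside the range of summation, but then twice its size exceeds `n` and the
    -- indicator on the right vanishes as well.
    ... | no κ≰n = ≈-trans
      (∑-ε (compositions≤ n) λ {γ} γ∈ → ≈-trans
        (*-congʳ (⟦⟧-false (κ ≟ᶜ γ) λ { refl → κ≰n (∈-compositions≤⇒∣∣≤ n γ∈) })) (zeroˡ _))
      (≈-sym (≈-trans (*-congʳ (⟦⟧-false (∣ κ ∣ ℕ.+ ∣ κ ∣ ℕ.≟ n)
        λ { refl → κ≰n (ℕ.m≤m+n (∣ κ ∣) (∣ κ ∣)) })) (zeroˡ _)))

  -- The second factor 1 leaves M_κ to the kernel, which thereby contributes H_κ on the left: what
  -- remains is the coefficient of H_α in H_κ x. It is written as a sum over the cuts of `α`, the
  -- form in which the skew side also arrives.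
  coefficient₂-kernel-⋆ : ∀ n x α κ →
    coefficient₂ ((kernel ⋆ fromNQ (x ⊗ Q.1#)) n) α κ ≈
    ⟦ ∣ α ∣ ℕ.+ ∣ κ ∣ ℕ.≟ n ⟧ * ∑D α λ α₁ α₂ → coefficient x α₂ * δ α₁ κ
  coefficient₂-kernel-⋆ n x α κ = begin
    coefficient₂ ((kernel ⋆ fromNQ (x ⊗ Q.1#)) n) α κ
      ≈⟨ ∑-++-fold (λ i → kernel i N⊗Q.* totalComponent (n ∸ i) (x ⊗ Q.1#)) is _ ⟩
    ∑ is (λ i → coefficient₂ (kernel i N⊗Q.* totalComponent (n ∸ i) (x ⊗ Q.1#)) α κ)
      ≈⟨ ∑-cong is summand ⟩
    ∑ is (λ i → ⟦ k ℕ.≟ i ⟧ * eval x λ γ → ⟦ ∣ γ ∣ ℕ.≟ n ∸ i ⟧ * δ (κ ++ γ) α)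
      ≈⟨ ∑-cong is (λ i → eval-*ˡ x _ _) ⟨
    ∑ is (λ i → eval x λ γ → ⟦ k ℕ.≟ i ⟧ * (⟦ ∣ γ ∣ ℕ.≟ n ∸ i ⟧ * δ (κ ++ γ) α))
      ≈⟨ eval-∑ x is _ ⟨
    eval x (λ γ → ∑ is λ i → ⟦ k ℕ.≟ i ⟧ * (⟦ ∣ γ ∣ ℕ.≟ n ∸ i ⟧ * δ (κ ++ γ) α))
      ≈⟨ eval-cong x (λ γ → ≈-trans (∑-cong is λ i → ≈-sym (*-assoc _ _ _))
           (≈-trans (≈-sym (*-distribʳ-∑ _ is _))
             (≈-trans (*-congʳ (∑-⟦⟧-convolution k (∣ γ ∣) n)) (*-comm _ _)))) ⟩
    eval x (λ γ → δ (κ ++ γ) α * ⟦ k ℕ.+ ∣ γ ∣ ℕ.≟ n ⟧)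
      ≈⟨ eval-cong x (λ γ → ≈-trans
           (⟦⟧-*-cong ((κ ++ γ) ≟ᶜ α) λ { refl → ⟦⟧-⇔ (k ℕ.+ ∣ γ ∣ ℕ.≟ n) (∣ κ ++ γ ∣ ℕ.+ ∣ κ ∣ ℕ.≟ n)
              (≡.trans (degree γ)) (≡.trans (≡.sym (degree γ))) })
           (*-comm _ _)) ⟩
    eval x (λ γ → ⟦ ∣ α ∣ ℕ.+ ∣ κ ∣ ℕ.≟ n ⟧ * δ (κ ++ γ) α)
      ≈⟨ eval-*ˡ x _ _ ⟩
    ⟦ ∣ α ∣ ℕ.+ ∣ κ ∣ ℕ.≟ n ⟧ * eval x (λ γ → δ (κ ++ γ) α)
      ≈⟨ *-congˡ (∑D-coefficient x κ α) ⟨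
    ⟦ ∣ α ∣ ℕ.+ ∣ κ ∣ ℕ.≟ n ⟧ * ∑D α (λ α₁ α₂ → coefficient x α₂ * δ α₁ κ) ∎
    where
    is : List ℕ
    is = upTo (suc n)

    k : ℕ
    k = ∣ κ ∣ ℕ.+ ∣ κ ∣

    degree : ∀ γ → ∣ κ ++ γ ∣ ℕ.+ ∣ κ ∣ ≡ k ℕ.+ ∣ γ ∣
    degree γ = ≡.trans (≡.cong (ℕ._+ ∣ κ ∣) (++-∣∣ κ γ)) (ℕ-+.xy∙z≈xz∙y (∣ κ ∣) (∣ γ ∣) (∣ κ ∣))

    summand : ∀ i → coefficient₂ (kernel i N⊗Q.* totalComponent (n ∸ i) (x ⊗ Q.1#)) α κ ≈
      ⟦ k ℕ.≟ i ⟧ * eval x λ γ → ⟦ ∣ γ ∣ ℕ.≟ n ∸ i ⟧ * δ (κ ++ γ) α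
    summand i = begin
      coefficient₂ (kernel i N⊗Q.* totalComponent (n ∸ i) (x ⊗ Q.1#)) α κ
        ≈⟨ eval₂-* concatenation quasiShuffle (kernel i) (totalComponent (n ∸ i) (x ⊗ Q.1#)) _ ⟩
      eval₂ (kernel i) (λ γ γ′ → eval₂ (totalComponent (n ∸ i) (x ⊗ Q.1#)) λ ζ ζ′ →
        ∑Q γ′ ζ′ (λ τ → δ (γ ++ ζ) α * δ τ κ) + 0#)
        ≈⟨ eval₂-cong (kernel i) inner ⟩
      eval₂ (kernel i) (λ γ γ′ → eval x (λ ζ → ⟦ ∣ ζ ∣ ℕ.≟ n ∸ i ⟧ * δ (γ ++ ζ) α) * δ γ′ κ)
        ≈⟨ eval₂-kernel-δ i κ (λ γ → eval x λ ζ → ⟦ ∣ ζ ∣ ℕ.≟ n ∸ i ⟧ * δ (γ ++ ζ) α) ⟩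
      ⟦ k ℕ.≟ i ⟧ * eval x (λ γ → ⟦ ∣ γ ∣ ℕ.≟ n ∸ i ⟧ * δ (κ ++ γ) α) ∎
      where
      inner : ∀ γ γ′ → eval₂ (totalComponent (n ∸ i) (x ⊗ Q.1#)) (λ ζ ζ′ →
          ∑Q γ′ ζ′ (λ τ → δ (γ ++ ζ) α * δ τ κ) + 0#)
        ≈ eval x (λ ζ → ⟦ ∣ ζ ∣ ℕ.≟ n ∸ i ⟧ * δ (γ ++ ζ) α) * δ γ′ κ
      inner γ γ′ = begin
        eval₂ (totalComponent (n ∸ i) (x ⊗ Q.1#)) g
          ≈⟨ eval₂-totalComponent (n ∸ i) (x ⊗ Q.1#) g ⟩
        eval₂ (x ⊗ Q.1#) (λ ζ ζ′ → ⟦ ∣ ζ ∣ ℕ.+ ∣ ζ′ ∣ ℕ.≟ n ∸ i ⟧ * g ζ ζ′)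
          ≈⟨ eval₂-⊗ x Q.1# (λ ζ ζ′ → ⟦ ∣ ζ ∣ ℕ.+ ∣ ζ′ ∣ ℕ.≟ n ∸ i ⟧ * g ζ ζ′) ⟩
        eval x (λ ζ → eval (basis []) λ ζ′ → ⟦ ∣ ζ ∣ ℕ.+ ∣ ζ′ ∣ ℕ.≟ n ∸ i ⟧ * g ζ ζ′)
          ≈⟨ eval-cong x (λ ζ → ≈-trans
               (eval-basis [] λ ζ′ → ⟦ ∣ ζ ∣ ℕ.+ ∣ ζ′ ∣ ℕ.≟ n ∸ i ⟧ * g ζ ζ′)
               (*-cong (⟦⟧-⇔ (∣ ζ ∣ ℕ.+ 0 ℕ.≟ n ∸ i) (∣ ζ ∣ ℕ.≟ n ∸ i)
                          (≡.trans (≡.sym (ℕ.+-identityʳ (∣ ζ ∣)))) (≡.trans (ℕ.+-identityʳ (∣ ζ ∣))))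
                       (≈-trans (+-identityʳ _) (∑Q-[]ʳ γ′ λ τ → δ (γ ++ ζ) α * δ τ κ)))) ⟩
        eval x (λ ζ → ⟦ ∣ ζ ∣ ℕ.≟ n ∸ i ⟧ * (δ (γ ++ ζ) α * δ γ′ κ))
          ≈⟨ eval-cong x (λ ζ → ≈-sym (*-assoc _ _ _)) ⟩
        eval x (λ ζ → ⟦ ∣ ζ ∣ ℕ.≟ n ∸ i ⟧ * δ (γ ++ ζ) α * δ γ′ κ)
          ≈⟨ eval-*ʳ x _ _ ⟩
        eval x (λ ζ → ⟦ ∣ ζ ∣ ℕ.≟ n ∸ i ⟧ * δ (γ ++ ζ) α) * δ γ′ κ ∎
        where
        g : Functional₂
        g ζ ζ′ = ∑Q γ′ ζ′ (λ τ → δ (γ ++ ζ) α * δ τ κ) + 0#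

  -- The transition matrix from M to 𝒮

  weight : Composition → Composition → Carrier
  weight α β = tableauCount α (toList β) ×ᴷ 1#

  eval-𝒮 : ∀ {α n} f → ∣ α ∣ ≡ n → eval (𝒮 α) f ≈ ∑ (compositions n) λ β → weight α β * f β
  eval-𝒮 {α} f refl = reflexive (∑-map _ (compositions (∣ α ∣)) _)

  eval-𝒮-cong : ∀ α {f g} → (∀ {β} → ∣ β ∣ ≡ ∣ α ∣ → f β ≈ g β) → eval (𝒮 α) f ≈ eval (𝒮 α) g
  eval-𝒮-cong α {f} {g} f≈g = begin
    eval (𝒮 α) f                                      ≈⟨ eval-𝒮 {α} f refl ⟩
    ∑ (compositions (∣ α ∣)) (λ β → weight α β * f β)
      ≈⟨ ∑-cong-∈ (compositions (∣ α ∣)) (λ β∈ → *-congˡ (f≈g (∈-compositions⇒∣∣ (∣ α ∣) β∈))) ⟩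
    ∑ (compositions (∣ α ∣)) (λ β → weight α β * g β) ≈⟨ eval-𝒮 {α} g refl ⟨
    eval (𝒮 α) g                                      ∎

  ∑-lookup : ∀ (is : List I) f → ∑ is f ≈ sum λ k → f (lookup is k)
  ∑-lookup []       f = ≈-refl
  ∑-lookup (i ∷ is) f = +-congˡ (∑-lookup is f)

  -- Inverting the transition matrix by duality, and its consequences for skew elements

  module _ {𝐬 : Composition → ⟪ NSym ⟫} (dual : IsDualBasis 𝐬) where

    s : Composition → Composition → Carrier
    s α = coefficient (𝐬 α)

    weight-s : ∀ {n α} β → ∣ α ∣ ≡ n → ∑ (compositions n) (λ γ → weight α γ * s β γ) ≈ δ β α
    weight-s {n} {α} β α⊢n = ≈-trans (≈-sym (eval-𝒮 {α} (s β) α⊢n)) (dual β α)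

    -- Duality says that the coefficients of `𝐬` form a right inverse of the matrix `weight` in
    -- degree `n`. The matrix is square, so elimination makes it injective.
    weight-injective : ∀ n (x : Composition → Carrier) →
      (∀ {β} → ∣ β ∣ ≡ n → ∑ (compositions n) (λ γ → weight β γ * x γ) ≈ 0#) →
      ∀ {γ} → ∣ γ ∣ ≡ n → x γ ≈ 0#
    weight-injective n x weight-x≈0 {γ} refl = ≡.subst (λ γ → x γ ≈ 0#)
      (≡.sym (lookup-index γ∈)) (vanishes (Any.index γ∈))
      where
      γ∈ : γ ∈ compositions n
      γ∈ = ∈-compositions γ

      row : Fin (length (compositions n)) → Composition
      row = lookup (compositions n)

      row-∣∣ : ∀ k → ∣ row k ∣ ≡ n
      row-∣∣ k = ∈-compositions⇒∣∣ n (∈-lookup {xs = compositions n} k)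

      vanishes : ∀ k → x (row k) ≈ 0#
      vanishes = injective-if-right-inverse _
        (λ k l → weight (row k) (row l)) (λ l k → s (row k) (row l))
        (λ k → ≈-trans (≈-sym (∑-lookup (compositions n) _))
          (≈-trans (weight-s (row k) (row-∣∣ k)) (⟦⟧-true (row k ≟ᶜ row k) refl)))
        (λ {k} {l} k≢l → ≈-trans (≈-sym (∑-lookup (compositions n) _))
          (≈-trans (weight-s (row l) (row-∣∣ k)) (⟦⟧-false (row l ≟ᶜ row k)
            λ eq → k≢l (≡.sym (lookup-injective (compositions-unique n) eq)))))
        (x ∘ row)
        (λ k → ≈-trans (≈-sym (∑-lookup (compositions n) _)) (weight-x≈0 {row k} (row-∣∣ k)))

    -- The part of 𝐬_ρ in a degree other than |ρ| pairs to zero with every 𝒮_β of that degree, hence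
    -- vanishes by injectivity.
    s-homogeneous : ∀ {ρ γ} → ∣ ρ ∣ ≢ ∣ γ ∣ → s ρ γ ≈ 0#
    s-homogeneous {ρ} {γ} ρ≢γ = weight-injective (∣ γ ∣) (s ρ)
      (λ {β} β⊢ → ≈-trans (weight-s ρ β⊢)
        (⟦⟧-false (ρ ≟ᶜ β) λ { refl → ρ≢γ β⊢ })) refl

    -- A right inverse of an injective matrix is a left inverse: W (S W - 1) = (W S) W - W = 0, so S
    -- W = 1.
    s-weight : ∀ {n κ γ} → ∣ κ ∣ ≡ n → ∣ γ ∣ ≡ n →
               ∑ (compositions n) (λ ρ → s ρ κ * weight ρ γ) ≈ δ κ γ
    s-weight {n} {κ} {γ} κ⊢n γ⊢n = x∙y⁻¹≈ε⇒x≈y _ _ (weight-injective n x (λ {β} → weight-x≈0 {β}) κ⊢n)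
      where
      cs : List Composition
      cs = compositions n

      x : Composition → Carrier
      x κ = ∑ cs (λ ρ → s ρ κ * weight ρ γ) - δ κ γ

      weight-x≈0 : ∀ {β} → ∣ β ∣ ≡ n → ∑ cs (λ κ → weight β κ * x κ) ≈ 0#
      weight-x≈0 {β} refl = begin
        ∑ cs (λ κ → weight β κ * x κ)
          ≈⟨ ≈-trans (∑-cong cs λ κ → distribˡ _ _ _) (∑-∙ cs _ _) ⟩
        ∑ cs (λ κ → weight β κ * ∑ cs λ ρ → s ρ κ * weight ρ γ) + ∑ cs (λ κ → weight β κ * - δ κ γ)
          ≈⟨ +-cong first second ⟩
        weight β γ - weight β γ
          ≈⟨ -‿inverseʳ _ ⟩
        0# ∎
        where
        first : ∑ cs (λ κ → weight β κ * ∑ cs λ ρ → s ρ κ * weight ρ γ) ≈ weight β γ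
        first = begin
          ∑ cs (λ κ → weight β κ * ∑ cs λ ρ → s ρ κ * weight ρ γ)
            ≈⟨ ∑-cong cs (λ κ → ≈-trans (*-distribˡ-∑ _ cs _)
                 (∑-cong cs λ ρ → ≈-sym (*-assoc _ _ _))) ⟩
          ∑ cs (λ κ → ∑ cs λ ρ → weight β κ * s ρ κ * weight ρ γ)
            ≈⟨ ∑-swap cs cs _ ⟩
          ∑ cs (λ ρ → ∑ cs λ κ → weight β κ * s ρ κ * weight ρ γ)
            ≈⟨ ∑-cong cs (λ ρ → ≈-trans (≈-sym (*-distribʳ-∑ _ cs _))
                 (*-congʳ (≈-trans (weight-s ρ refl) (δ-sym ρ β)))) ⟩
          ∑ cs (λ ρ → δ β ρ * weight ρ γ)
            ≈⟨ ∑-select (compositions-unique n) (∈-compositions β) (β ≟ᶜ_) _ ⟩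
          weight β γ ∎

        second : ∑ cs (λ κ → weight β κ * - δ κ γ) ≈ - weight β γ
        second = ≈-trans
          (∑-cong cs λ κ → ≈-trans (≈-sym (-‿distribʳ-* _ _)) (≈-trans
            (-‿cong (≈-trans (*-comm _ _) (*-congʳ (δ-sym κ γ)))) (-‿distribʳ-* _ _)))
          (∑-select (compositions-unique n) (≡.subst (λ n → γ ∈ compositions n) γ⊢n (∈-compositions γ))
            (γ ≟ᶜ_) _)

    -- Expands the basis element M_κ in the 𝒮_ρ.
    ∑≤-s-𝒮 : ∀ {m κ} → ∣ κ ∣ ≤ m → ∀ G → ∑≤ m (λ ρ → s ρ κ * eval (𝒮 ρ) G) ≈ G κ
    ∑≤-s-𝒮 {m} {κ} κ≤m G = begin
      ∑≤ m (λ ρ → s ρ κ * eval (𝒮 ρ) G)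
        ≈⟨ ∑-concatMap compositions (upTo (suc m)) _ ⟩
      ∑ (upTo (suc m)) (λ n → ∑ (compositions n) λ ρ → s ρ κ * eval (𝒮 ρ) G)
        ≈⟨ ∑-isolate (Unique.upTo⁺ (suc m)) (∈-upTo⁺ (s≤s κ≤m)) _ (λ {n} _ n≢∣κ∣ →
             ∑-ε (compositions n) λ ρ∈ → ≈-trans
               (*-congʳ (s-homogeneous λ eq → n≢∣κ∣ (≡.trans (≡.sym (∈-compositions⇒∣∣ n ρ∈)) eq)))
               (zeroˡ _)) ⟩
      ∑ cs (λ ρ → s ρ κ * eval (𝒮 ρ) G)
        ≈⟨ ∑-cong-∈ cs (λ {ρ} ρ∈ → ≈-trans
             (*-congˡ (eval-𝒮 {ρ} G (∈-compositions⇒∣∣ (∣ κ ∣) ρ∈)))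
             (≈-trans (*-distribˡ-∑ _ cs _) (∑-cong cs λ γ → ≈-sym (*-assoc _ _ _)))) ⟩
      ∑ cs (λ ρ → ∑ cs λ γ → s ρ κ * weight ρ γ * G γ)
        ≈⟨ ∑-swap cs cs _ ⟩
      ∑ cs (λ γ → ∑ cs λ ρ → s ρ κ * weight ρ γ * G γ)
        ≈⟨ ∑-cong-∈ cs (λ {γ} γ∈ → ≈-trans (≈-sym (*-distribʳ-∑ _ cs _))
             (*-congʳ (s-weight {κ = κ} {γ} refl (∈-compositions⇒∣∣ (∣ κ ∣) γ∈)))) ⟩
      ∑ cs (λ γ → δ κ γ * G γ)
        ≈⟨ ∑-select (compositions-unique (∣ κ ∣)) (∈-compositions κ) (κ ≟ᶜ_) G ⟩
      G κ ∎
      where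
      cs : List Composition
      cs = compositions (∣ κ ∣)

    -- Skew functions

    module _ {𝐬[_/_] : Composition → Composition → ⟪ NSym ⟫} (skew𝐬 : IsSkewOf𝐬 𝐬 𝐬[_/_]) where

      quasiShuffle-𝐬 : ∀ lam {m} → proj₁ (skew𝐬 lam) ≤ m → ∀ α β →
        ∑Q α β (s lam) ≈ ∑≤ m λ ν → coefficient 𝐬[ lam / ν ] α * s ν β
      quasiShuffle-𝐬 lam {m} ≤m α β = ≈-trans (≈-sym (coefficient₂-Δ (𝐬 lam) α β)) (≈-trans
        (eval₂-≈ concatenation concatenation (proj₂ (skew𝐬 lam) m ≤m) _)
        (eval₂-∑⊗ (compositions≤ m) 𝐬[ lam /_] 𝐬 _ _))

      -- Pairing the right factor of Δ 𝐬_ρ with 𝒮_μ isolates one skew element. The bound `m` is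
      -- large enough both for the expansion of the coproduct to hold and for `μ` to occur in it.
      coefficient-skew𝐬 : ∀ ρ μ α →
        coefficient 𝐬[ ρ / μ ] α ≈ eval (𝒮 μ) λ β → ∑Q α β (s ρ)
      coefficient-skew𝐬 ρ μ α = ≈-sym (begin
        eval (𝒮 μ) (λ β → ∑Q α β (s ρ))
          ≈⟨ eval-cong (𝒮 μ) (λ β → quasiShuffle-𝐬 ρ (ℕ.m≤m⊔n _ _) α β) ⟩
        eval (𝒮 μ) (λ β → ∑≤ m λ ν → coefficient 𝐬[ ρ / ν ] α * s ν β)
          ≈⟨ eval-∑ (𝒮 μ) (compositions≤ m) _ ⟩
        ∑≤ m (λ ν → eval (𝒮 μ) λ β → coefficient 𝐬[ ρ / ν ] α * s ν β)
          ≈⟨ ∑-cong (compositions≤ m) (λ ν → ≈-trans (eval-*ˡ (𝒮 μ) _ (s ν))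
               (≈-trans (*-congˡ (≈-trans (dual ν μ) (δ-sym ν μ))) (*-comm _ _))) ⟩
        ∑≤ m (λ ν → δ μ ν * coefficient 𝐬[ ρ / ν ] α)
          ≈⟨ ∑≤-δ {m} {μ} (ℕ.m≤n⊔m _ _) _ ⟩
        coefficient 𝐬[ ρ / μ ] α ∎)
        where
        m : ℕ
        m = proj₁ (skew𝐬 ρ) ℕ.⊔ ∣ μ ∣

    module _ {𝒮[_/_] : Composition → Composition → ⟪ QSym ⟫} (skew𝒮 : IsSkewOf𝒮 𝒮[_/_]) where

      deconcatenation-𝒮 : ∀ lam {m} → proj₁ (skew𝒮 lam) ≤ m → ∀ f →
        eval (𝒮 lam) (λ κ → ∑D κ f) ≈ ∑≤ m λ μ → eval 𝒮[ lam / μ ] λ β → eval (𝒮 μ) (f β)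
      deconcatenation-𝒮 lam {m} ≤m f = ≈-trans (≈-sym (eval₂-Δ∨ (𝒮 lam) f)) (≈-trans
        (eval₂-≈ quasiShuffle quasiShuffle (proj₂ (skew𝒮 lam) m ≤m) f)
        (≈-trans (∑-++-fold (λ μ → 𝒮[ lam / μ ] ⊗ 𝒮 μ) (compositions≤ m) _)
          (∑-cong (compositions≤ m) λ μ → eval₂-⊗ 𝒮[ lam / μ ] (𝒮 μ) f)))

      -- The mirror image of `coefficient-skew𝐬`: pairing with 𝐬_μ isolates one term of the
      -- coproduct of 𝒮.
      eval-skew𝒮 : ∀ lam μ g →
        eval 𝒮[ lam / μ ] g ≈ eval (𝒮 lam) λ κ → ∑D κ λ β γ → g β * s μ γ
      eval-skew𝒮 lam μ g = ≈-sym (begin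
        eval (𝒮 lam) (λ κ → ∑D κ λ β γ → g β * s μ γ)
          ≈⟨ deconcatenation-𝒮 lam (ℕ.m≤m⊔n _ _) _ ⟩
        ∑≤ m (λ ν → eval 𝒮[ lam / ν ] λ β → eval (𝒮 ν) λ γ → g β * s μ γ)
          ≈⟨ ∑-cong (compositions≤ m) (λ ν → ≈-trans
               (eval-cong 𝒮[ lam / ν ] λ β → ≈-trans (eval-*ˡ (𝒮 ν) (g β) (s μ))
                 (≈-trans (*-congˡ (dual μ ν)) (*-comm _ _)))
               (eval-*ˡ 𝒮[ lam / ν ] (δ μ ν) g)) ⟩
        ∑≤ m (λ ν → δ μ ν * eval 𝒮[ lam / ν ] g)
          ≈⟨ ∑≤-δ {m} {μ} (ℕ.m≤n⊔m _ _) _ ⟩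
        eval 𝒮[ lam / μ ] g ∎)
        where
        m : ℕ
        m = proj₁ (skew𝒮 lam) ℕ.⊔ ∣ μ ∣

      -- The right piece of a cut has size at most |lam|, where 𝐬_μ has no coefficients. This bounds
      -- μ in the double sum, and through μ the relevant ρ.
      skew𝒮-vanishes : ∀ {lam μ} → ∣ lam ∣ < ∣ μ ∣ → ∀ g → eval 𝒮[ lam / μ ] g ≈ 0#
      skew𝒮-vanishes {lam} {μ} lam<μ g = ≈-trans (eval-skew𝒮 lam μ g) (≈-trans
        (eval-𝒮-cong lam λ {κ} κ⊢ → ∑-ε (deconcatenations κ) λ {(β , γ)} βγ∈ → ≈-trans
          (*-congˡ (s-homogeneous λ μ≡γ → ℕ.<⇒≱ lam<μ (≡.subst₂ _≤_ (≡.sym μ≡γ) κ⊢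
            (deconcatenations-∣∣ κ βγ∈)))) (zeroʳ _))
        (eval-0 (𝒮 lam) λ _ → ≈-refl))
        where
        deconcatenations-∣∣ : ∀ κ {β γ} → (β , γ) ∈ deconcatenations κ → ∣ γ ∣ ≤ ∣ κ ∣
        deconcatenations-∣∣ []      (here refl) = z≤n
        deconcatenations-∣∣ (a ∷ κ) (here refl) = ℕ.≤-refl
        deconcatenations-∣∣ (a ∷ κ) (there βγ∈) with _ , βγ∈′ , refl ← ∈-map⁻ _ βγ∈ =
          ℕ.≤-trans (deconcatenations-∣∣ κ βγ∈′) (ℕ.m≤n+m _ ⌊ a ⌋)

      -- Both sides pair the third factor of the iterated coproduct of 𝒮_eta with 𝐬_ν;
      -- coassociativity of deconcatenation identifies the two ways of iterating.
      coassociativity-𝒮 : ∀ eta {m} → proj₁ (skew𝒮 eta) ≤ m → ∀ ν h →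
        ∑≤ m (λ μ → eval 𝒮[ eta / μ ] λ β → eval 𝒮[ μ / ν ] (h β))
        ≈ eval 𝒮[ eta / ν ] λ κ → ∑D κ h
      coassociativity-𝒮 eta {m} ≤m ν h = begin
        ∑≤ m (λ μ → eval 𝒮[ eta / μ ] λ β → eval 𝒮[ μ / ν ] (h β))
          ≈⟨ ∑-cong (compositions≤ m) (λ μ → eval-cong 𝒮[ eta / μ ] λ β → eval-skew𝒮 μ ν (h β)) ⟩
        ∑≤ m (λ μ → eval 𝒮[ eta / μ ] λ β → eval (𝒮 μ) λ κ → ∑D κ λ γ ε → h β γ * s ν ε)
          ≈⟨ deconcatenation-𝒮 eta ≤m _ ⟨
        eval (𝒮 eta) (λ ω → ∑D ω λ β κ → ∑D κ λ γ ε → h β γ * s ν ε)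
          ≈⟨ eval-cong (𝒮 eta) (λ ω → ≈-trans (∑D-assoc ω _)
               (∑D-cong ω λ κ ε → ≈-sym (*-distribʳ-∑ (s ν ε) (deconcatenations κ) _))) ⟩
        eval (𝒮 eta) (λ ω → ∑D ω λ κ ε → ∑D κ h * s ν ε)
          ≈⟨ eval-skew𝒮 eta ν _ ⟨
        eval 𝒮[ eta / ν ] (λ κ → ∑D κ h) ∎

      -- Applying the counit to the left factor of Δ∨ 𝒮_eta returns 𝒮_eta, whose pairing with 𝐬_ν is
      -- δ.
      coefficient-skew𝒮-[] : ∀ eta ν → coefficient 𝒮[ eta / ν ] [] ≈ δ ν eta
      coefficient-skew𝒮-[] eta ν = ≈-trans (eval-skew𝒮 eta ν λ β → δ β []) (≈-trans
        (eval-cong (𝒮 eta) λ κ → ∑D-δ[] κ (s ν)) (dual ν eta))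
        where
        ∑D-δ[] : ∀ κ f → ∑D κ (λ β γ → δ β [] * f γ) ≈ f κ
        ∑D-δ[] [] f = ≈-trans (+-identityʳ _) (*-identityˡ _)
        ∑D-δ[] (a ∷ κ) f = ≈-trans (∑D-∷ a κ _) (≈-trans
          (+-cong (*-identityˡ _) (∑-ε (deconcatenations κ) λ _ → zeroˡ _)) (+-identityʳ _))

    ∑𝐬⊗𝒮⟶kernel : (λ m → N⊗Q.∑≤ m λ α → 𝐬 α ⊗ 𝒮 α) ⟶ kernel
    ∑𝐬⊗𝒮⟶kernel n = n , λ m n≤m → coefficient₂-injective concatenation quasiShuffle
      (totalComponent n (N⊗Q.∑≤ m λ α → 𝐬 α ⊗ 𝒮 α)) (kernel n) λ α β → begin
      coefficient₂ (totalComponent n (N⊗Q.∑≤ m λ α → 𝐬 α ⊗ 𝒮 α)) α β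
        ≈⟨ coefficient₂-totalComponent n (N⊗Q.∑≤ m λ α → 𝐬 α ⊗ 𝒮 α) α β ⟩
      ⟦ ∣ α ∣ ℕ.+ ∣ β ∣ ℕ.≟ n ⟧ * coefficient₂ (N⊗Q.∑≤ m λ α → 𝐬 α ⊗ 𝒮 α) α β
        ≈⟨ *-congˡ (eval₂-∑⊗ (compositions≤ m) 𝐬 𝒮 _ _) ⟩
      ⟦ ∣ α ∣ ℕ.+ ∣ β ∣ ℕ.≟ n ⟧ * ∑≤ m (λ γ → s γ α * coefficient (𝒮 γ) β)
        -- In total degree `n` the size of `α` is at most `n`, hence at most `m`: the partial sum
        -- already contains every 𝒮_γ in the expansion of M_α, and the coefficient of M_β there is
        -- δ.
        ≈⟨ ⟦⟧-*-cong (∣ α ∣ ℕ.+ ∣ β ∣ ℕ.≟ n) (λ { refl → ≈-trans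
             (∑≤-s-𝒮 {m} {α} (ℕ.≤-trans (ℕ.m≤m+n (∣ α ∣) (∣ β ∣)) n≤m) λ γ → δ γ β)
             (≈-sym (≈-trans (∑-cong (compositions≤ n) λ γ → *-congʳ (δ-sym γ α))
               (∑≤-δ {n} {α} (ℕ.m≤m+n (∣ α ∣) (∣ β ∣)) λ γ → δ γ β))) }) ⟩
      ⟦ ∣ α ∣ ℕ.+ ∣ β ∣ ℕ.≟ n ⟧ * ∑≤ n (λ γ → δ γ α * δ γ β)
        ≈⟨ *-congˡ (≈-trans (eval₂-∑⊗ (compositions≤ n) basis basis _ _)
             (∑-cong (compositions≤ n) λ γ → *-cong (eval-basis γ λ ζ → δ ζ α) (eval-basis γ λ ζ → δ ζ β))) ⟨
      ⟦ ∣ α ∣ ℕ.+ ∣ β ∣ ℕ.≟ n ⟧ * coefficient₂ (N⊗Q.∑≤ n λ γ → basis γ ⊗ basis γ) α β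
        ≈⟨ coefficient₂-totalComponent n (N⊗Q.∑≤ n λ γ → basis γ ⊗ basis γ) α β ⟨
      coefficient₂ (kernel n) α β ∎

    -- The skew Cauchy identity

    module _
      {𝐬[_/_] : Composition → Composition → ⟪ NSym ⟫} (skew𝐬 : IsSkewOf𝐬 𝐬 𝐬[_/_])
      {𝒮[_/_] : Composition → Composition → ⟪ QSym ⟫} (skew𝒮 : IsSkewOf𝒮 𝒮[_/_])
      where

      -- The right side is the coefficient of H_α in the kernel times ∑ 𝐬_{lam/ν} ⊗ 𝒮_{μ/ν}, with
      -- `g` applied to the second factor: a cut of `α` writes H_α as H_{α₁} H_{α₂}, and the kernel
      -- contributes H_{α₁} ⊗ M_{α₁}.
      ∑≤-skew𝐬-skew𝒮 : ∀ lam μ α {m m′} → ∣ α ∣ ℕ.+ ∣ μ ∣ ≤ m → proj₁ (skew𝐬 lam) ≤ m′ → ∀ g →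
        ∑≤ m (λ ρ → coefficient 𝐬[ ρ / μ ] α * eval 𝒮[ ρ / lam ] g) ≈
        ∑D α λ α₁ α₂ → ∑≤ m′ λ ν →
          coefficient 𝐬[ lam / ν ] α₂ * eval 𝒮[ μ / ν ] λ β → ∑Q α₁ β g
      ∑≤-skew𝐬-skew𝒮 lam μ α {m} {m′} ≤m ≤m′ g = begin
        ∑≤ m (λ ρ → coefficient 𝐬[ ρ / μ ] α * eval 𝒮[ ρ / lam ] g)
          ≈⟨ ∑-cong (compositions≤ m) (λ ρ → ≈-trans
               (*-cong (coefficient-skew𝐬 skew𝐬 ρ μ α) (eval-skew𝒮 skew𝒮 ρ lam g))
               (≈-trans (≈-sym (eval-*ʳ (𝒮 μ) (eval (𝒮 ρ) G) λ β → ∑Q α β (s ρ)))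
                 (eval-cong (𝒮 μ) λ β → *-distribʳ-∑ _ (quasiShuffle α β) (s ρ)))) ⟩
        ∑≤ m (λ ρ → eval (𝒮 μ) λ β → ∑Q α β λ κ → s ρ κ * eval (𝒮 ρ) G)
          ≈⟨ eval-∑ (𝒮 μ) (compositions≤ m) _ ⟨
        eval (𝒮 μ) (λ β → ∑≤ m λ ρ → ∑Q α β λ κ → s ρ κ * eval (𝒮 ρ) G)
          -- Only β of size |μ| occur in 𝒮_μ, so each quasi-shuffle κ has size |α| + |μ|, within the
          -- bound. The sum over ρ is then the full expansion of M_κ and collapses to `G κ`.
          ≈⟨ eval-𝒮-cong μ (λ {β} ∣β∣≡∣μ∣ → ≈-trans
               (∑-swap (compositions≤ m) (quasiShuffle α β) _)
               (∑-cong-∈ (quasiShuffle α β) λ {κ} κ∈ → ∑≤-s-𝒮 {m} {κ}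
                 (≡.subst (_≤ m) (≡.sym (≡.trans (quasiShuffle-∣∣ α β κ∈)
                   (≡.cong (∣ α ∣ ℕ.+_) ∣β∣≡∣μ∣))) ≤m) G)) ⟩
        eval (𝒮 μ) (λ β → ∑Q α β G)
          ≈⟨ eval-cong (𝒮 μ) (λ β → deconcatenation-quasiShuffle α β _) ⟩
        eval (𝒮 μ) (λ β → ∑D α λ α₁ α₂ → ∑D β λ β₁ β₂ →
          ∑Q α₁ β₁ λ κ → ∑Q α₂ β₂ λ ε → g κ * s lam ε)
          ≈⟨ eval-∑ (𝒮 μ) (deconcatenations α) _ ⟩
        ∑D α (λ α₁ α₂ → eval (𝒮 μ) λ β → ∑D β λ β₁ β₂ →
          ∑Q α₁ β₁ λ κ → ∑Q α₂ β₂ λ ε → g κ * s lam ε)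
          ≈⟨ ∑D-cong α summand ⟩
        ∑D α (λ α₁ α₂ → ∑≤ m′ λ ν →
          coefficient 𝐬[ lam / ν ] α₂ * eval 𝒮[ μ / ν ] λ β → ∑Q α₁ β g) ∎
        where
        G : Composition → Carrier
        G κ = ∑D κ λ β γ → g β * s lam γ

        summand : ∀ α₁ α₂ →
          eval (𝒮 μ) (λ β → ∑D β λ β₁ β₂ → ∑Q α₁ β₁ λ κ → ∑Q α₂ β₂ λ ε → g κ * s lam ε) ≈
          ∑≤ m′ λ ν → coefficient 𝐬[ lam / ν ] α₂ * eval 𝒮[ μ / ν ] λ β → ∑Q α₁ β g
        summand α₁ α₂ = begin
          eval (𝒮 μ) (λ β → ∑D β λ β₁ β₂ → ∑Q α₁ β₁ λ κ → ∑Q α₂ β₂ λ ε → g κ * s lam ε)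
            ≈⟨ eval-cong (𝒮 μ) (λ β → ∑D-cong β λ β₁ β₂ → begin
                 ∑Q α₁ β₁ (λ κ → ∑Q α₂ β₂ λ ε → g κ * s lam ε)
                   ≈⟨ ∑Q-cong α₁ β₁ (λ κ → *-distribˡ-∑ (g κ) (quasiShuffle α₂ β₂) (s lam)) ⟨
                 ∑Q α₁ β₁ (λ κ → g κ * ∑Q α₂ β₂ (s lam))
                   ≈⟨ *-distribʳ-∑ _ (quasiShuffle α₁ β₁) g ⟨
                 ∑Q α₁ β₁ g * ∑Q α₂ β₂ (s lam)
                   ≈⟨ *-congˡ (quasiShuffle-𝐬 skew𝐬 lam ≤m′ α₂ β₂) ⟩
                 ∑Q α₁ β₁ g * ∑≤ m′ (λ ν → d ν * s ν β₂)
                   ≈⟨ *-distribˡ-∑ _ (compositions≤ m′) _ ⟩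
                 ∑≤ m′ (λ ν → ∑Q α₁ β₁ g * (d ν * s ν β₂))
                   ≈⟨ ∑-cong (compositions≤ m′) (λ ν → x*yz≈y*xz _ _ _) ⟩
                 ∑≤ m′ (λ ν → d ν * (∑Q α₁ β₁ g * s ν β₂)) ∎) ⟩
          eval (𝒮 μ) (λ β → ∑D β λ β₁ β₂ → ∑≤ m′ λ ν → d ν * (∑Q α₁ β₁ g * s ν β₂))
            ≈⟨ eval-cong (𝒮 μ) (λ β → ≈-trans (∑-swap (deconcatenations β) (compositions≤ m′) _)
                 (∑-cong (compositions≤ m′) λ ν → ≈-sym (*-distribˡ-∑ (d ν) (deconcatenations β) _))) ⟩
          eval (𝒮 μ) (λ β → ∑≤ m′ λ ν → d ν * ∑D β λ β₁ β₂ → ∑Q α₁ β₁ g * s ν β₂)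
            ≈⟨ eval-∑ (𝒮 μ) (compositions≤ m′) _ ⟩
          ∑≤ m′ (λ ν → eval (𝒮 μ) λ β → d ν * ∑D β λ β₁ β₂ → ∑Q α₁ β₁ g * s ν β₂)
            ≈⟨ ∑-cong (compositions≤ m′) (λ ν → ≈-trans (eval-*ˡ (𝒮 μ) (d ν) _)
                 (*-congˡ (≈-sym (eval-skew𝒮 skew𝒮 μ ν λ β → ∑Q α₁ β g)))) ⟩
          ∑≤ m′ (λ ν → d ν * eval 𝒮[ μ / ν ] λ β → ∑Q α₁ β g) ∎
          where
          d : Composition → Carrier
          d ν = coefficient 𝐬[ lam / ν ] α₂

      module _ {S∨ : ⟪ QSym ⟫ → ⟪ QSym ⟫} (isAntipode : IsAntipode S∨) (lam eta : Composition) where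

        skewSum : ℕ → ⟪ NQ ⟫
        skewSum m = N⊗Q.∑≤ m λ ρ → N⊗Q.∑≤ m λ μ →
          𝐬[ ρ / μ ] ⊗ (S∨ 𝒮[ eta / μ ] Q.* 𝒮[ ρ / lam ])

        -- The bound |α| + |eta| makes the sum over ρ complete for every μ of size at most |eta|;
        -- larger μ contribute nothing. The second bound makes the sum over μ a complete coproduct
        -- of 𝒮_eta.
        coefficient₂-skewSum : ∀ {m} α κ → ∣ α ∣ ℕ.+ ∣ eta ∣ ≤ m → proj₁ (skew𝒮 eta) ≤ m →
          coefficient₂ (skewSum m) α κ ≈ ∑D α λ α₁ α₂ → coefficient 𝐬[ lam / eta ] α₂ * δ α₁ κ
        coefficient₂-skewSum {m} α κ α+η≤m ≤m = begin
          coefficient₂ (skewSum m) α κ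
            ≈⟨ ≈-trans (∑-++-fold (λ ρ → N⊗Q.∑≤ m λ μ →
                 𝐬[ ρ / μ ] ⊗ (S∨ 𝒮[ eta / μ ] Q.* 𝒮[ ρ / lam ])) (compositions≤ m) _)
                 (∑-cong (compositions≤ m) λ ρ → eval₂-∑⊗ (compositions≤ m) 𝐬[ ρ /_]
                   (λ μ → S∨ 𝒮[ eta / μ ] Q.* 𝒮[ ρ / lam ]) _ _) ⟩
          ∑≤ m (λ ρ → ∑≤ m λ μ → u ρ μ * coefficient (S∨ 𝒮[ eta / μ ] Q.* 𝒮[ ρ / lam ]) κ)
            ≈⟨ ∑-swap (compositions≤ m) (compositions≤ m) _ ⟩
          ∑≤ m (λ μ → ∑≤ m λ ρ → u ρ μ * coefficient (S∨ 𝒮[ eta / μ ] Q.* 𝒮[ ρ / lam ]) κ)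
            ≈⟨ ∑-cong (compositions≤ m) summand ⟩
          ∑≤ m (λ μ → eval 𝒮[ eta / μ ] (T μ))
            ≈⟨ ∑-cong (compositions≤ m) (λ μ → ≈-trans
                 (eval-∑ 𝒮[ eta / μ ] (deconcatenations α) _) (∑D-cong α λ α₁ α₂ → ≈-trans
                 (eval-∑ 𝒮[ eta / μ ] (compositions≤ m′) _) (∑-cong (compositions≤ m′) λ ν →
                 eval-*ˡ 𝒮[ eta / μ ] (d ν α₂) _))) ⟩
          ∑≤ m (λ μ → ∑D α λ α₁ α₂ → ∑≤ m′ λ ν →
            d ν α₂ * eval 𝒮[ eta / μ ] λ β → eval 𝒮[ μ / ν ] λ γ → Ψ α₁ β γ)
            ≈⟨ ≈-trans (∑-swap (compositions≤ m) (deconcatenations α) _) (∑D-cong α λ α₁ α₂ → ≈-trans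
                 (∑-swap (compositions≤ m) (compositions≤ m′) _) (∑-cong (compositions≤ m′) λ ν →
                 ≈-sym (*-distribˡ-∑ (d ν α₂) (compositions≤ m) _))) ⟩
          ∑D α (λ α₁ α₂ → ∑≤ m′ λ ν →
            d ν α₂ * ∑≤ m λ μ → eval 𝒮[ eta / μ ] λ β → eval 𝒮[ μ / ν ] λ γ → Ψ α₁ β γ)
            ≈⟨ ∑D-cong α (λ α₁ α₂ → ∑-cong (compositions≤ m′) λ ν → ≈-trans
                 (*-congˡ (cancel α₁ ν)) (x*yz≈y*xz _ _ _)) ⟩
          ∑D α (λ α₁ α₂ → ∑≤ m′ λ ν → δ eta ν * (d ν α₂ * δ α₁ κ))
            ≈⟨ ∑D-cong α (λ α₁ α₂ → ∑≤-δ {m′} {eta} (ℕ.m≤n⊔m _ _) _) ⟩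
          ∑D α (λ α₁ α₂ → d eta α₂ * δ α₁ κ) ∎
          where
          m′ : ℕ
          m′ = proj₁ (skew𝐬 lam) ℕ.⊔ ∣ eta ∣

          u d : Composition → Composition → Carrier
          u ρ μ = coefficient 𝐬[ ρ / μ ] α
          d ν α₂ = coefficient 𝐬[ lam / ν ] α₂

          h : Composition → Composition → Carrier
          h α₁ τ = ∑Q τ α₁ λ ω → δ ω κ

          -- The coefficient of M_κ in S∨(M_β) M_γ M_{α₁}.
          Ψ : Composition → Composition → Composition → Carrier
          Ψ α₁ β γ = eval (S∨ (basis β)) λ σ → ∑Q σ γ (h α₁)

          T : Composition → Composition → Carrier
          T μ β = ∑D α λ α₁ α₂ → ∑≤ m′ λ ν → d ν α₂ * eval 𝒮[ μ / ν ] λ γ → Ψ α₁ β γ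

          cancel : ∀ α₁ ν →
            ∑≤ m (λ μ → eval 𝒮[ eta / μ ] λ β → eval 𝒮[ μ / ν ] λ γ → Ψ α₁ β γ) ≈ δ eta ν * δ α₁ κ
          cancel α₁ ν = begin
            ∑≤ m (λ μ → eval 𝒮[ eta / μ ] λ β → eval 𝒮[ μ / ν ] λ γ → Ψ α₁ β γ)
              ≈⟨ coassociativity-𝒮 skew𝒮 eta ≤m ν (Ψ α₁) ⟩
            eval 𝒮[ eta / ν ] (λ ω → ∑D ω (Ψ α₁))
              ≈⟨ antipode-inverseˡ isAntipode 𝒮[ eta / ν ] (h α₁) ⟩
            coefficient 𝒮[ eta / ν ] [] * h α₁ []
              ≈⟨ *-cong (≈-trans (coefficient-skew𝒮-[] skew𝒮 eta ν) (δ-sym ν eta))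
                        (∑Q-[]ˡ α₁ λ ω → δ ω κ) ⟩
            δ eta ν * δ α₁ κ ∎

          g : Composition → Composition → Carrier
          g σ ζ = ∑Q σ ζ λ τ → δ τ κ

          -- Commutativity of QSym moves the kernel factor M_{α₁} to the right end, so that S∨(M_β)
          -- stands next to M_γ and the antipode axiom applies.
          reassociate : ∀ α₁ γ σ → ∑Q α₁ γ (g σ) ≈ ∑Q σ γ (h α₁)
          reassociate α₁ γ σ = ≈-trans (quasiShuffle-comm α₁ γ (g σ))
            (≈-sym (quasiShuffle-assoc σ γ α₁ λ τ → δ τ κ))

          -- `U` keeps the sum over ρ, with S∨(M_β) multiplying 𝒮_{ρ/lam}; `T` is what it becomes
          -- after ρ is summed out.
          U : Composition → Composition → Carrier
          U μ β = eval (S∨ (basis β)) λ σ → ∑≤ m λ ρ → u ρ μ * eval 𝒮[ ρ / lam ] (g σ)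

          U≈T : ∀ μ β → ∣ μ ∣ ≤ ∣ eta ∣ → U μ β ≈ T μ β
          U≈T μ β μ≤η = begin
            U μ β
              ≈⟨ eval-cong (S∨ (basis β)) (λ σ → ∑≤-skew𝐬-skew𝒮 lam μ α
                   (ℕ.≤-trans (ℕ.+-monoʳ-≤ (∣ α ∣) μ≤η) α+η≤m) (ℕ.m≤m⊔n _ _) (g σ)) ⟩
            eval (S∨ (basis β)) (λ σ → ∑D α λ α₁ α₂ → ∑≤ m′ λ ν →
              d ν α₂ * eval 𝒮[ μ / ν ] λ γ → ∑Q α₁ γ (g σ))
              ≈⟨ ≈-trans (eval-∑ (S∨ (basis β)) (deconcatenations α) _) (∑D-cong α λ α₁ α₂ →
                 ≈-trans (eval-∑ (S∨ (basis β)) (compositions≤ m′) _) (∑-cong (compositions≤ m′) λ ν →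
                 ≈-trans (eval-*ˡ (S∨ (basis β)) (d ν α₂) _) (*-congˡ (eval-swap (S∨ (basis β)) 𝒮[ μ / ν ] _)))) ⟩
            ∑D α (λ α₁ α₂ → ∑≤ m′ λ ν →
              d ν α₂ * eval 𝒮[ μ / ν ] λ γ → eval (S∨ (basis β)) λ σ → ∑Q α₁ γ (g σ))
              ≈⟨ ∑D-cong α (λ α₁ α₂ → ∑-cong (compositions≤ m′) λ ν → *-congˡ
                   (eval-cong 𝒮[ μ / ν ] λ γ → eval-cong (S∨ (basis β)) (reassociate α₁ γ))) ⟩
            T μ β ∎

          summand : ∀ μ →
            ∑≤ m (λ ρ → u ρ μ * coefficient (S∨ 𝒮[ eta / μ ] Q.* 𝒮[ ρ / lam ]) κ) ≈
            eval 𝒮[ eta / μ ] (T μ)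
          summand μ = begin
            ∑≤ m (λ ρ → u ρ μ * coefficient (S∨ 𝒮[ eta / μ ] Q.* 𝒮[ ρ / lam ]) κ)
              ≈⟨ ∑-cong (compositions≤ m) (λ ρ → *-congˡ (≈-trans
                   (eval-* quasiShuffle (S∨ 𝒮[ eta / μ ]) 𝒮[ ρ / lam ] λ τ → δ τ κ)
                   (eval-S∨ isAntipode 𝒮[ eta / μ ] λ σ → eval 𝒮[ ρ / lam ] (g σ)))) ⟩
            ∑≤ m (λ ρ → u ρ μ * eval 𝒮[ eta / μ ] λ β → eval (S∨ (basis β)) λ σ → eval 𝒮[ ρ / lam ] (g σ))
              ≈⟨ ∑-cong (compositions≤ m) (λ ρ → ≈-trans (≈-sym (eval-*ˡ 𝒮[ eta / μ ] (u ρ μ) _))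
                   (eval-cong 𝒮[ eta / μ ] λ β → ≈-sym (eval-*ˡ (S∨ (basis β)) (u ρ μ) _))) ⟩
            ∑≤ m (λ ρ → eval 𝒮[ eta / μ ] λ β → eval (S∨ (basis β)) λ σ → u ρ μ * eval 𝒮[ ρ / lam ] (g σ))
              ≈⟨ ≈-trans (eval-cong 𝒮[ eta / μ ] λ β → eval-∑ (S∨ (basis β)) (compositions≤ m) _)
                         (eval-∑ 𝒮[ eta / μ ] (compositions≤ m) _) ⟨
            eval 𝒮[ eta / μ ] (U μ)
              ≈⟨ U⇒T (∣ μ ∣ ℕ.≤? ∣ eta ∣) ⟩
            eval 𝒮[ eta / μ ] (T μ) ∎
            where
            U⇒T : Dec (∣ μ ∣ ≤ ∣ eta ∣) → eval 𝒮[ eta / μ ] (U μ) ≈ eval 𝒮[ eta / μ ] (T μ)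
            U⇒T (yes μ≤η) = eval-cong 𝒮[ eta / μ ] λ β → U≈T μ β μ≤η
            -- Here the bound on ρ may fail and `U` need not equal `T`, but the functional of
            -- 𝒮_{eta/μ} applied to them is zero.
            U⇒T (no μ≰η)  = ≈-trans (skew𝒮-vanishes skew𝒮 {eta} {μ} (ℕ.≰⇒> μ≰η) _)
              (≈-sym (skew𝒮-vanishes skew𝒮 {eta} {μ} (ℕ.≰⇒> μ≰η) _))

        skewSum⟶kernel-⋆ : skewSum ⟶ kernel ⋆ fromNQ (𝐬[ lam / eta ] ⊗ Q.1#)
        -- In total degree `n` the size of `α` is at most `n`, which gives `n + ∣ eta ∣`; `N` is
        -- where the coproduct of 𝒮_eta has stabilised.
        skewSum⟶kernel-⋆ n = (n ℕ.+ ∣ eta ∣) ℕ.⊔ N , λ m ≤m →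
          coefficient₂-injective concatenation quasiShuffle
            (totalComponent n (skewSum m)) ((kernel ⋆ fromNQ (𝐬[ lam / eta ] ⊗ Q.1#)) n) λ α κ → begin
          coefficient₂ (totalComponent n (skewSum m)) α κ
            ≈⟨ coefficient₂-totalComponent n (skewSum m) α κ ⟩
          ⟦ ∣ α ∣ ℕ.+ ∣ κ ∣ ℕ.≟ n ⟧ * coefficient₂ (skewSum m) α κ
            ≈⟨ ⟦⟧-*-cong (∣ α ∣ ℕ.+ ∣ κ ∣ ℕ.≟ n) (λ { refl → coefficient₂-skewSum α κ
                 (ℕ.≤-trans (ℕ.+-monoˡ-≤ (∣ eta ∣) (ℕ.m≤m+n (∣ α ∣) (∣ κ ∣)))
                            (ℕ.m⊔n≤o⇒m≤o (n ℕ.+ ∣ eta ∣) N ≤m))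
                 (ℕ.m⊔n≤o⇒n≤o (n ℕ.+ ∣ eta ∣) N ≤m) }) ⟩
          ⟦ ∣ α ∣ ℕ.+ ∣ κ ∣ ℕ.≟ n ⟧ * ∑D α (λ α₁ α₂ → coefficient 𝐬[ lam / eta ] α₂ * δ α₁ κ)
            ≈⟨ coefficient₂-kernel-⋆ n 𝐬[ lam / eta ] α κ ⟨
          coefficient₂ ((kernel ⋆ fromNQ (𝐬[ lam / eta ] ⊗ Q.1#)) n) α κ ∎
          where
          N : ℕ
          N = proj₁ (skew𝒮 eta)

theorem5p1 : ∀ {c ℓ₁ ℓ₂ a ℓa b ℓb} (F : HeytingField c ℓ₁ ℓ₂) →
    let open Over F in
    CharacteristicZero →
    (AX : CommutativeAlgebra a ℓa) (AY : CommutativeAlgebra b ℓb)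
    (evX : ⟪ NSym ⟫ → ⟪ rawAlgebra AX ⟫) (evY : ⟪ QSym ⟫ → ⟪ rawAlgebra AY ⟫) →
    IsAlgebraHomomorphism NSym (rawAlgebra AX) evX →
    IsAlgebraHomomorphism QSym (rawAlgebra AY) evY →
    (S∨ : ⟪ QSym ⟫ → ⟪ QSym ⟫) → IsAntipode S∨ →
    (𝐬 : Composition → ⟪ NSym ⟫) → IsDualBasis 𝐬 →
    (𝐬[_/_] : Composition → Composition → ⟪ NSym ⟫) → IsSkewOf𝐬 𝐬 𝐬[_/_] →
    (𝒮[_/_] : Composition → Composition → ⟪ QSym ⟫) → IsSkewOf𝒮 𝒮[_/_] →
    let module Q  = RawAlgebra QSym
        module NQ = RawAlgebra NQ
        module XY = RawAlgebra (rawAlgebra AX ⊗ᴬ rawAlgebra AY)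
    in
    (lam eta : Composition) →
    ∃₂ λ (E R : Series) →
      ((λ m → NQ.∑≤ m λ α → 𝐬 α ⊗ 𝒮 α) ⟶ E)
      × ((λ m → NQ.∑≤ m λ ρ → NQ.∑≤ m λ μ →
            𝐬[ ρ / μ ] ⊗ (S∨ 𝒮[ eta / μ ] Q.* 𝒮[ ρ / lam ])) ⟶ R)
      × (∀ n → (evX ⊗₁ evY) ((E ⋆ fromNQ (𝐬[ lam / eta ] ⊗ Q.1#)) n)
               XY.≈ (evX ⊗₁ evY) (R n))
theorem5p1 F _ _ _ _ _ _ _ S∨ isAntipode 𝐬 dual 𝐬[_/_] skew𝐬 𝒮[_/_] skew𝒮 lam eta =
  -- The limit of the double sum is taken to be the product itself. The content lies in the two
  -- convergence statements, and the evaluated components then agree by reflexivity.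
  kernel , kernel ⋆ fromNQ (𝐬[ lam / eta ] ⊗ RawAlgebra.1# QSym)
  , ∑𝐬⊗𝒮⟶kernel dual
  , skewSum⟶kernel-⋆ dual skew𝐬 skew𝒮 isAntipode lam eta
  , λ n → Over.≈-refl
  where
  open Over F
  open Duality F
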